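{- For every sufficiently large natural number $n$ and every natural number $\alpha$ the following holds: if $x_1, \ldots, x_t \in \{0,1\}^n$ are pairwise $\alpha$-independent, i.e. $C(x_i) - C(x_i \mid x_j) \leq \alpha$ for all $i \neq j$ in $\{1,\ldots,t\}$, then $t < 2n^3 \cdot 2^\alpha$.
   Context: $C(x)$ denotes the plain Kolmogorov complexity of the binary string $x$ with respect to a fixed universal Turing machine; $C(x \mid y)$ denotes the conditional plain Kolmogorov complexity of $x$ given $y$ with respect to a fixed universal conditional machine. Logarithms are base $2$.
   Formalization: The strings x_1, …, x_t are assumed pairwise distinct; with repetitions the claim fails, e.g. x_i = 0^n for all i with α = C(0^n) and t arbitrarily large. -}

module Defs where

open import Data.Bool using (Bool)
open import Data.Fin using (Fin; zero; _↑ʳ_)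
open import Data.Integer as ℤ using (+_; _-_)
open import Data.List using (List; []; _∷_; length)
import Data.List as List
open import Data.Maybe using (Maybe; just; nothing)
import Data.Maybe as Maybe
open import Data.Nat using (ℕ; suc; _+_; _≤_)
open import Data.Product using (_×_; _,_; ∃-syntax)
open import Data.Vec using (Vec; []; _∷_; _++_; map; zipWith; replicate; lookup; toList)
open import Relation.Binary.PropositionalEquality using (_≡_; _≢_)

BitString : Set
BitString = List Bool

-- The tape alphabet is {0, 1, blank}, with nothing as the blank.
Symbol : Set
Symbol = Maybe Bool

pattern blank = nothing

data Move : Set where
  left stay right : Move

-- A two-way infinite tape. Both lists are ordered outwards from the head,
-- and every cell beyond their ends is blank.
record Tape : Set where
  constructor tape
  field
    before : List Symbol
    head   : Symbol
    after  : List Symbol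

open Tape public

moveHead : Move → Tape → Tape
moveHead left  (tape []      h r)       = tape [] blank (h ∷ r)
moveHead left  (tape (s ∷ l) h r)       = tape l s (h ∷ r)
moveHead stay  t                        = t
moveHead right (tape l       h [])      = tape (h ∷ l) blank []
moveHead right (tape l       h (s ∷ r)) = tape (h ∷ l) s r

act : Symbol × Move → Tape → Tape
act (s , m) t = moveHead m (tape (before t) s (after t))

blankTape : Tape
blankTape = tape [] blank []

-- The head starts on the first bit.
load : BitString → Tape
load []       = blankTape
load (b ∷ bs) = tape [] (just b) (List.map just bs)

bitsUntilBlank : List Symbol → BitString
bitsUntilBlank []           = []
bitsUntilBlank (blank  ∷ _) = []
bitsUntilBlank (just b ∷ s) = b ∷ bitsUntilBlank s

contents : Tape → BitString
contents t = bitsUntilBlank (head t ∷ after t)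

-- Deterministic multi-tape Turing machines with a inputs: a input tapes,
-- one output tape, and any number of further work tapes, in that order.
-- All tapes may be read and written. The machine halts where δ is nothing.
record TM (a : ℕ) : Set where
  field
    states workTapes : ℕ

  tapes : ℕ
  tapes = a + suc workTapes

  field
    start : Fin states
    δ     : Fin states → Vec Symbol tapes →
            Maybe (Fin states × Vec (Symbol × Move) tapes)

  Config : Set
  Config = Fin states × Vec Tape tapes

  initial : Vec BitString a → Config
  initial ins = start , map load ins ++ replicate (suc workTapes) blankTape

  step : Config → Maybe Config
  step (q , ts) =
    Maybe.map (λ (q′ , as) → q′ , zipWith act as ts) (δ q (map head ts))

  output : Config → BitString
  output (_ , ts) = contents (lookup ts (a ↑ʳ zero))

  data _⇓_ : Config → Config → Set where
    halted : ∀ {c} → step c ≡ nothing → c ⇓ c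
    next   : ∀ {c c′ d} → step c ≡ just c′ → c′ ⇓ d → c ⇓ d

-- Run on the inputs ins, the machine M halts with output x.
_computes_from_ : ∀ {a} → TM a → BitString → Vec BitString a → Set
M computes x from ins = ∃[ c ] (initial ins ⇓ c × output c ≡ x)
  where open TM M

-- The first input of a machine is the program, the remaining a inputs are the
-- conditions: a = 0 is the plain case and a = 1 the conditional one.
-- Universality is that of the invariance theorem: simulating M costs at most
-- an additive constant in program length.
Universal : ∀ {a} → TM (suc a) → Set
Universal {a} U =
  (M : TM (suc a)) → ∃[ c ] ∀ p (ys : Vec BitString a) x →
  M computes x from (p ∷ ys) →
  ∃[ q ] (length q ≤ length p + c × U computes x from (q ∷ ys))

-- k is the least length of a program from which U computes x given ys.
-- Complexity is a relation because the minimum is not computable.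
IsComplexity : ∀ {a} → TM (suc a) → BitString → Vec BitString a → ℕ → Set
IsComplexity U x ys k =
  (∃[ p ] (length p ≡ k × U computes x from (p ∷ ys))) ×
  (∀ p → U computes x from (p ∷ ys) → k ≤ length p)

C[_]_≔_ : TM 1 → BitString → ℕ → Set
C[ U ] x ≔ k = IsComplexity U x [] k

C[_]_∣_≔_ : TM 2 → BitString → BitString → ℕ → Set
C[ V ] x ∣ y ≔ k = IsComplexity V x (y ∷ []) k

-- C(x i) - C(x i | x j) ≤ α for all i ≢ j. For universal U and V the two
-- complexities exist and are unique classically, but they cannot be exhibited
-- constructively, so they are quantified universally.
PairwiseIndependent : TM 1 → TM 2 → ℕ → ∀ {n t} → (Fin t → Vec Bool n) → Set
PairwiseIndependent U V α x =
  ∀ i j → i ≢ j →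
  ∀ k l → C[ U ] toList (x i) ≔ k → C[ V ] toList (x i) ∣ toList (x j) ≔ l →
  (+ k - + l) ℤ.≤ + α

{-# OPTIONS --safe #-}
module Submission where

-- Suppose t is too large and let m = α + O(1) + 3/2 log n. A machine that dovetails
-- over the programs of length k = C(xᵢ) turns xᵢ, m and k - m into one particular
-- shortest program of xᵢ. There are n + O(1) values of k and 2 ^ m prefixes of
-- length m, so by pigeonhole two strings xᵢ and xⱼ of the same complexity have
-- such programs with the same prefix. Given xᵢ, the string xⱼ is then determined
-- by m and the k - m remaining bits of its program, so C(xⱼ ∣ xᵢ) < k - α.

open import Defs
open import Data.Bool using (Bool; true; false; if_then_else_)
open import Data.Empty using (⊥; ⊥-elim)
open import Data.Fin using (Fin; combine; fromℕ<; _↑ʳ_)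
import Data.Fin as Fin
open import Data.Fin.Patterns
open import Data.Fin.Properties
  using (2↔Bool; +↔⊎; *↔×; combine-injective; fromℕ<-injective; pigeonhole; sequence; <⇒≢)
import Data.Integer as ℤ
import Data.Integer.Properties as ℤ
open import Data.List using (List; []; _∷_; length; _ʳ++_)
import Data.List as List
import Data.List.Properties as List
open import Data.Maybe using (Maybe; just; nothing)
import Data.Maybe as Maybe
open import Data.Maybe.Properties using (just-injective)
open import Data.Nat
  using (ℕ; zero; suc; _+_; _*_; _^_; _∸_; _≤_; _<_; z≤n; s≤s; _≤?_; _<?_)
open import Data.Nat.Properties hiding (<⇒≢)
open import Data.Nat.Solver using (module +-*-Solver)
open import Data.Product using (_×_; _,_; ∃-syntax; proj₁; proj₂)
open import Data.Product.Function.NonDependent.Propositional using (_×-↔_)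
open import Data.Sum using (_⊎_; inj₁; inj₂)
open import Data.Vec using (Vec; []; _∷_; _++_; map; zipWith; replicate; lookup; toList)
import Data.Vec.Properties as Vec
open import Data.Vec.Relation.Unary.All using (All; []; _∷_)
open import Effect.Monad using (RawMonad)
open import Function using (_↔_; Inverse; _∘_)
open import Function.Construct.Composition using (_↔-∘_)
open import Function.Definitions using (Injective)
open import Relation.Binary.Construct.Closure.ReflexiveTransitive using (Star; ε; _◅_; _◅◅_)
open import Relation.Binary.PropositionalEquality
open import Relation.Nullary using (¬_; yes; no)
open import Relation.Nullary.Decidable using (¬¬-excluded-middle)
open import Relation.Nullary.Negation using (¬¬-Monad)

-- Tapes without trailing blanks

-- A prefix found for one string can serve another because the search uses only the number `k - m`
-- of remaining bits, never the bits themselves: the prefix is settled before they are substituted.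
-- That number is the length of the unread input, so only `m` needs a self-delimiting code. With
-- `4 ^ E ≤ n < 4 ^ suc E` this code has 3 E + O(1) bits, and for large `n` the pigeonhole thereby
-- loses a factor below 2^(4 E) ≤ n²; the at most 2 n values of `k` supply the rest of the bound.
-- Since `α` is not bounded in terms of `n`, `m` may exceed `k`. A program that short is taken whole
-- as the key, and distinct strings cannot share it. Candidates may run forever, so every trial is
-- timed, and each candidate meets arbitrarily long clocks. Complexities exist only up to double
-- negation. As the conclusion is a decidable inequality, they may be assumed for all of the
-- finitely many strings at once.

infixr 5 _∷ᵇ_

_∷ᵇ_ : Symbol → List Symbol → List Symbol
blank  ∷ᵇ []      = []
blank  ∷ᵇ (s ∷ l) = blank ∷ s ∷ l
just b ∷ᵇ l       = just b ∷ l

hd : List Symbol → Symbol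
hd []      = blank
hd (s ∷ _) = s

tl : List Symbol → List Symbol
tl []      = []
tl (_ ∷ l) = l

trim : List Symbol → List Symbol
trim []      = []
trim (s ∷ l) = s ∷ᵇ trim l

norm : Tape → Tape
norm (tape l h r) = tape (trim l) h (trim r)

-- moveHead and act on tapes without trailing blanks: there equal contents mean
-- equal tapes, and moving the head back and forth changes nothing.
shift : Move → Tape → Tape
shift left  (tape l h r) = tape (tl l) (hd l) (h ∷ᵇ r)
shift stay  t            = t
shift right (tape l h r) = tape (h ∷ᵇ l) (hd r) (tl r)

put : Symbol × Move → Tape → Tape
put (s , m) t = shift m (tape (before t) s (after t))

hd-∷ᵇ : ∀ s l → hd (s ∷ᵇ l) ≡ s
hd-∷ᵇ (just _) l       = refl
hd-∷ᵇ blank    []      = refl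
hd-∷ᵇ blank    (_ ∷ _) = refl

tl-∷ᵇ : ∀ s l → tl (s ∷ᵇ l) ≡ l
tl-∷ᵇ (just _) l       = refl
tl-∷ᵇ blank    []      = refl
tl-∷ᵇ blank    (_ ∷ _) = refl

shift-norm : ∀ m t → shift m (norm t) ≡ norm (moveHead m t)
shift-norm left  (tape []      h r)       = refl
shift-norm left  (tape (s ∷ l) h r)       =
  cong₂ (λ l′ h′ → tape l′ h′ (h ∷ᵇ trim r)) (tl-∷ᵇ s (trim l)) (hd-∷ᵇ s (trim l))
shift-norm stay  t                        = refl
shift-norm right (tape l       h [])      = refl
shift-norm right (tape l       h (s ∷ r)) =
  cong₂ (tape (h ∷ᵇ trim l)) (hd-∷ᵇ s (trim r)) (tl-∷ᵇ s (trim r))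

put-norm : ∀ a t → put a (norm t) ≡ norm (act a t)
put-norm (s , m) t = shift-norm m (tape (before t) s (after t))

bitsUntilBlank-trim : ∀ l → bitsUntilBlank (trim l) ≡ bitsUntilBlank l
bitsUntilBlank-trim []           = refl
bitsUntilBlank-trim (just b ∷ l) = cong (b ∷_) (bitsUntilBlank-trim l)
bitsUntilBlank-trim (blank  ∷ l) with trim l
... | []    = refl
... | _ ∷ _ = refl

contents-norm : ∀ t → contents (norm t) ≡ contents t
contents-norm (tape _ blank    r) = refl
contents-norm (tape _ (just b) r) = cong (b ∷_) (bitsUntilBlank-trim r)

-- at l z is the tape reverse l ++ z with its head on the first bit of z.
at : BitString → BitString → Tape
at l z = tape (List.map just l) (hd (List.map just z)) (tl (List.map just z))

leftOf : BitString → BitString → Tape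
leftOf []      z = tape [] blank (List.map just z)
leftOf (b ∷ l) z = at l (b ∷ z)

shift-left : ∀ l z → shift left (at l z) ≡ leftOf l z
shift-left []      []      = refl
shift-left []      (_ ∷ _) = refl
shift-left (_ ∷ _) []      = refl
shift-left (_ ∷ _) (_ ∷ _) = refl

trim-just : ∀ z → trim (List.map just z) ≡ List.map just z
trim-just []      = refl
trim-just (b ∷ z) = cong (just b ∷_) (trim-just z)

norm-load : ∀ z → norm (load z) ≡ at [] z
norm-load []      = refl
norm-load (b ∷ z) = cong (tape [] (just b)) (trim-just z)

contents-at : ∀ l z → contents (at l z) ≡ z
contents-at l []      = refl
contents-at l (b ∷ z) = cong (b ∷_) (bits z)
  where
  bits : ∀ z → bitsUntilBlank (List.map just z) ≡ z
  bits []      = refl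
  bits (b ∷ z) = cong (b ∷_) (bits z)

-- Runs on trimmed tapes

module Run {a} (T : TM a) where
  open TM T public

  stepᶜ : Config → Maybe Config
  stepᶜ (q , ts) = Maybe.map (λ (q′ , as) → q′ , zipWith put as ts) (δ q (map head ts))

  stepᶜ-nothing : ∀ {q ts} → δ q (map head ts) ≡ nothing → stepᶜ (q , ts) ≡ nothing
  stepᶜ-nothing e rewrite e = refl

  stepᶜ-just : ∀ {q ts q′ as} → δ q (map head ts) ≡ just (q′ , as) →
    stepᶜ (q , ts) ≡ just (q′ , zipWith put as ts)
  stepᶜ-just e rewrite e = refl

  -- The step count is what the clock of a trial is later compared with.
  data Halts : ℕ → Config → Config → Set where
    stop : ∀ {c} → stepᶜ c ≡ nothing → Halts 0 c c
    more : ∀ {s c c′ d} → stepᶜ c ≡ just c′ → Halts s c′ d → Halts (suc s) c d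

  normC : Config → Config
  normC (q , ts) = q , map norm ts

  initialᶜ : Vec BitString a → Config
  initialᶜ ins = start , map (at []) ins ++ replicate (suc workTapes) blankTape

  Computes : BitString → Vec BitString a → Set
  Computes x ins = ∃[ s ] ∃[ d ] (Halts s (initialᶜ ins) d × output d ≡ x)

  zipWith-put-norm : ∀ {n} (as : Vec (Symbol × Move) n) ts →
    zipWith put as (map norm ts) ≡ map norm (zipWith act as ts)
  zipWith-put-norm []       []       = refl
  zipWith-put-norm (a ∷ as) (t ∷ ts) = cong₂ _∷_ (put-norm a t) (zipWith-put-norm as ts)

  head-norm : ∀ {n} (ts : Vec Tape n) → map head (map norm ts) ≡ map head ts
  head-norm []       = refl
  head-norm (t ∷ ts) = cong (head t ∷_) (head-norm ts)

  -- Trimming leaves the scanned symbols alone, so `δ` takes the same branch on both sides.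
  step-norm : ∀ c → stepᶜ (normC c) ≡ Maybe.map normC (step c)
  step-norm (q , ts) rewrite head-norm ts with δ q (map head ts)
  ... | nothing        = refl
  ... | just (q′ , as) = cong (λ us → just (q′ , us)) (zipWith-put-norm as ts)

  halts-norm : ∀ {c d} → c ⇓ d → ∃[ s ] Halts s (normC c) (normC d)
  halts-norm {c} (halted e) = 0 , stop (trans (step-norm c) (cong (Maybe.map normC) e))
  halts-norm {c} (next e r) =
    let s , h = halts-norm r
    in suc s , more (trans (step-norm c) (cong (Maybe.map normC) e)) h

  norm-halts : ∀ {s d} c → Halts s (normC c) d → ∃[ e ] (c ⇓ e × normC e ≡ d)
  norm-halts c (stop e) with step c in eq | step-norm c
  ... | nothing | _ = c , halted eq , refl
  ... | just _  | f with () ← trans (sym e) f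
  norm-halts c (more e h) with step c in eq | step-norm c
  ... | nothing | f with () ← trans (sym e) f
  ... | just c′ | f with refl ← just-injective (trans (sym e) f) =
    let e , r , p = norm-halts c′ h in e , next eq r , p

  output-norm : ∀ c → output (normC c) ≡ output c
  output-norm (_ , ts) =
    trans (cong contents (Vec.lookup-map (a ↑ʳ 0F) norm ts)) (contents-norm (lookup ts (a ↑ʳ 0F)))

  initial-norm : ∀ ins → normC (initial ins) ≡ initialᶜ ins
  initial-norm ins = cong (start ,_) (trans (Vec.map-++ norm (map load ins) _)
    (cong₂ _++_ (trans (sym (Vec.map-∘ norm load ins)) (Vec.map-cong norm-load ins))
                (Vec.map-replicate norm blankTape (suc workTapes))))

  computes⇒Computes : ∀ {x} ins → T computes x from ins → Computes x ins
  computes⇒Computes ins (d , r , e) with s , h ← halts-norm r =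
    s , normC d , subst (λ c → Halts s c (normC d)) (initial-norm ins) h , trans (output-norm d) e

  Computes⇒computes : ∀ {x} ins → Computes x ins → T computes x from ins
  Computes⇒computes ins (s , d , h , o)
    with e , r , refl ← norm-halts (initial ins) (subst (λ c → Halts s c d) (sym (initial-norm ins)) h) =
    e , r , trans (sym (output-norm e)) o

  Halts-deterministic : ∀ {s s′ c d d′} → Halts s c d → Halts s′ c d′ → d ≡ d′
  Halts-deterministic (stop _)   (stop _)    = refl
  Halts-deterministic (stop e)   (more e′ _) with () ← trans (sym e) e′
  Halts-deterministic (more e _) (stop e′)   with () ← trans (sym e) e′
  Halts-deterministic (more e h) (more e′ h′)
    with refl ← just-injective (trans (sym e) e′) = Halts-deterministic h h′

  Computes-deterministic : ∀ {x x′} ins → Computes x ins → Computes x′ ins → x ≡ x′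
  Computes-deterministic _ (_ , _ , h , o) (_ , _ , h′ , o′) =
    trans (sym o) (trans (cong output (Halts-deterministic h h′)) o′)

-- The searching machine

-- Writes its input from right to left, so x is computed from reverse x.
reverser : TM 1
reverser = record { states = 2 ; workTapes = 0 ; start = 0F ; δ = δ }
  where
  δ : Fin 2 → Vec Symbol 2 → Maybe (Fin 2 × Vec (Symbol × Move) 2)
  δ 0F (just b ∷ o ∷ []) = just (0F , (just b , right) ∷ (just b , left) ∷ [])
  δ 0F (blank ∷ o ∷ [])  = just (1F , (blank , stay) ∷ (o , right) ∷ [])
  δ 1F _                 = nothing

reverser-computes : ∀ p → reverser computes (p ʳ++ []) from (p ∷ [])
reverser-computes p = Computes⇒computes (p ∷ []) (run p [] [])
  where
  open Run reverser
  run : ∀ p l o → ∃[ s ] ∃[ d ]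
    (Halts s (0F , at l p ∷ leftOf [] o ∷ []) d × output d ≡ p ʳ++ o)
  run []      l o = 1 , _ , more refl (stop refl) , contents-at [] o
  run (b ∷ p) l o = let s , d , h , e = run p (b ∷ l) (b ∷ o) in suc s , d , more refl h , e

pattern 10F = Fin.suc 9F
pattern 11F = Fin.suc 10F
pattern 12F = Fin.suc 11F
pattern 13F = Fin.suc 12F
pattern 14F = Fin.suc 13F
pattern 15F = Fin.suc 14F
pattern 16F = Fin.suc 15F
pattern 17F = Fin.suc 16F

pattern parse  = inj₁ 0F
pattern dblA   = inj₁ 1F
pattern dblA′  = inj₁ 2F
pattern bitA   = inj₁ 3F
pattern dblM   = inj₁ 4F
pattern dblM′  = inj₁ 5F
pattern bitM   = inj₁ 6F
pattern loadP  = inj₁ 7F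
pattern loadM  = inj₁ 8F
pattern rewM   = inj₁ 9F
pattern rewP   = inj₁ 10F
pattern cmp    = inj₁ 11F
pattern rewY   = inj₁ 12F
pattern wipe₁  = inj₁ 13F
pattern wipe₂  = inj₁ 14F
pattern wipe₃  = inj₁ 15F
pattern inc    = inj₁ 16F
pattern rewZ   = inj₁ 17F
pattern sim q  = inj₂ q

-- Beyond its inputs P and Y, a program to be parsed and a condition y, the machine
-- has tapes M for m in unary, A for scratch, Z for a binary counter, and the tapes
-- of U, whose output tape serves as its own. The reversal of the first k bits of Z
-- is the candidate program. The flag in a state is set once a candidate is found
-- to compute y. Until then Z is also a clock, which advances with each simulated
-- step and ends the trial when it runs out. Hence all that U has written is erased
-- by going back on Z while wiping to the right (wipe₁), and then along Z and back
-- while wiping to the left (wipe₂, wipe₃).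
module Search (U : TM 1) where
  module U = Run U

  State : Set
  State = Bool × (Fin 18 ⊎ Fin U.states)

  stateCode : Fin (2 * (18 + U.states)) ↔ State
  stateCode = (2↔Bool ×-↔ +↔⊎) ↔-∘ *↔×

  -- The number of tapes of `U` is arbitrary, so a transition names an action on all of them instead
  -- of listing symbols.
  data Action (n : ℕ) : Set where
    idle      : Action n
    wipe      : Move → Action n
    onInput   : Symbol × Move → Action n
    onOutput  : Symbol × Move → Action n
    simulate  : Vec (Symbol × Move) n → Action n

  keeping moving← moving→ : Symbol → Symbol × Move
  keeping s = s , stay
  moving← s = s , left
  moving→ s = s , right

  symbols : Action U.tapes → Vec Symbol U.tapes → Vec (Symbol × Move) U.tapes
  symbols idle          us           = map keeping us
  symbols (wipe m)      us           = map (λ _ → blank , m) us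
  symbols (onInput a)   (i ∷ us)     = a ∷ map keeping us
  symbols (onOutput a)  (i ∷ o ∷ us) = keeping i ∷ a ∷ map keeping us
  symbols (simulate as) us           = as

  apply : Action U.tapes → Vec Tape U.tapes → Vec Tape U.tapes
  apply idle          us           = us
  apply (wipe m)      us           = map (put (blank , m)) us
  apply (onInput a)   (i ∷ us)     = put a i ∷ us
  apply (onOutput a)  (i ∷ o ∷ us) = i ∷ put a o ∷ us
  apply (simulate as) us           = zipWith put as us

  -- A counter too short for a candidate reads as if zeros followed. Loading writes these zeros back
  -- to Z.
  padded : Symbol → Symbol
  padded blank    = just false
  padded (just b) = just b

  -- Here `nothing` means that the comparison is still open.
  judge : Symbol → Symbol → Maybe Bool
  judge blank        blank        = just true
  judge (just true)  (just true)  = nothing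
  judge (just false) (just false) = nothing
  judge _            _            = just false

  Transition : Set
  Transition = Maybe (State × Vec (Symbol × Move) 5 × Action U.tapes)

  δ : State → Vec Symbol 5 → Vec Symbol U.tapes → Transition
  δ (f , parse) (just true ∷ y ∷ m ∷ a ∷ z ∷ []) us =
    just ((f , dblA) , (blank , right) ∷ keeping y ∷ moving→ m ∷ keeping a ∷ keeping z ∷ [] , idle)
  δ (f , parse) (just false ∷ y ∷ m ∷ a ∷ z ∷ []) us =
    just ((f , loadP) , (blank , right) ∷ keeping y ∷ moving→ m ∷ keeping a ∷ keeping z ∷ [] , idle)
  -- Each one erased from M puts two on A; `dblM` doubles back from A to M. A round trip multiplies
  -- by 4, which is why a digit consists of two bits.
  δ (f , dblA) (p ∷ y ∷ just _ ∷ a ∷ z ∷ []) us =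
    just ((f , dblA′) , keeping p ∷ keeping y ∷ (blank , right) ∷ (just true , left) ∷ keeping z ∷ [] , idle)
  δ (f , dblA) (p ∷ y ∷ blank ∷ a ∷ z ∷ []) us =
    just ((f , bitA) , keeping p ∷ keeping y ∷ (blank , stay) ∷ keeping a ∷ keeping z ∷ [] , idle)
  δ (f , dblA′) (p ∷ y ∷ m ∷ a ∷ z ∷ []) us =
    just ((f , dblA) , keeping p ∷ keeping y ∷ keeping m ∷ (just true , left) ∷ keeping z ∷ [] , idle)
  -- The head of A is on the blank just before its ones: writing there adds one, stepping right adds
  -- nothing.
  δ (f , bitA) (just b ∷ y ∷ m ∷ a ∷ z ∷ []) us =
    just ((f , dblM) , (blank , right) ∷ keeping y ∷ keeping m ∷
          (if b then (just true , stay) else moving→ a) ∷ keeping z ∷ [] , idle)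
  δ (f , dblM) (p ∷ y ∷ m ∷ just _ ∷ z ∷ []) us =
    just ((f , dblM′) , keeping p ∷ keeping y ∷ (just true , left) ∷ (blank , right) ∷ keeping z ∷ [] , idle)
  δ (f , dblM) (p ∷ y ∷ m ∷ blank ∷ z ∷ []) us =
    just ((f , bitM) , keeping p ∷ keeping y ∷ keeping m ∷ (blank , stay) ∷ keeping z ∷ [] , idle)
  δ (f , dblM′) (p ∷ y ∷ m ∷ a ∷ z ∷ []) us =
    just ((f , dblM) , keeping p ∷ keeping y ∷ (just true , left) ∷ keeping a ∷ keeping z ∷ [] , idle)
  δ (f , bitM) (just b ∷ y ∷ m ∷ a ∷ z ∷ []) us =
    just ((f , parse) , (blank , right) ∷ keeping y ∷
          (if b then (just true , left) else keeping m) ∷ keeping a ∷ keeping z ∷ [] , idle)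
  -- During the search P only measures how many bits to take from Z. After success its bits replace
  -- those of Z, while Z still advances, so that `loadM` finds the same prefix again.
  δ (f , loadP) (just c ∷ y ∷ m ∷ a ∷ z ∷ []) us =
    just ((f , loadP) , (just c , right) ∷ keeping y ∷ keeping m ∷ keeping a ∷ (padded z , right) ∷ [] ,
          onInput ((if f then just c else padded z) , left))
  δ (f , loadP) (blank ∷ y ∷ m ∷ a ∷ z ∷ []) us =
    just ((f , loadM) , keeping blank ∷ keeping y ∷ keeping m ∷ keeping a ∷ keeping z ∷ [] , idle)
  δ (f , loadM) (p ∷ y ∷ just c ∷ a ∷ z ∷ []) us =
    just ((f , loadM) , keeping p ∷ keeping y ∷ (just c , right) ∷ keeping a ∷ (padded z , right) ∷ [] ,
          onInput (padded z , left))
  δ (f , loadM) (p ∷ y ∷ blank ∷ a ∷ z ∷ []) us =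
    just ((f , rewM) , moving← p ∷ keeping y ∷ (blank , left) ∷ keeping a ∷ keeping z ∷ [] ,
          onInput (blank , right))
  δ (f , rewM) (p ∷ y ∷ just c ∷ a ∷ z ∷ []) us =
    just ((f , rewM) , keeping p ∷ keeping y ∷ (just c , left) ∷ keeping a ∷ keeping z ∷ [] , idle)
  δ (f , rewM) (p ∷ y ∷ blank ∷ a ∷ z ∷ []) us =
    just ((f , rewP) , keeping p ∷ keeping y ∷ (blank , right) ∷ keeping a ∷ keeping z ∷ [] , idle)
  δ (f , rewP) (just c ∷ y ∷ m ∷ a ∷ z ∷ []) us =
    just ((f , rewP) , (just c , left) ∷ keeping y ∷ keeping m ∷ keeping a ∷ keeping z ∷ [] , idle)
  δ (f , rewP) (blank ∷ y ∷ m ∷ a ∷ z ∷ []) us =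
    just ((f , sim U.start) , (blank , right) ∷ keeping y ∷ keeping m ∷ keeping a ∷ keeping z ∷ [] , idle)
  δ (false , sim q) (p ∷ y ∷ m ∷ a ∷ blank ∷ []) us =
    just ((false , rewY) , keeping p ∷ moving← y ∷ keeping m ∷ keeping a ∷ keeping blank ∷ [] , idle)
  δ (false , sim q) (p ∷ y ∷ m ∷ a ∷ just b ∷ []) us with U.δ q us
  ... | nothing =
    just ((false , cmp) , keeping p ∷ keeping y ∷ keeping m ∷ keeping a ∷ keeping (just b) ∷ [] , idle)
  ... | just (q′ , as) =
    just ((false , sim q′) , keeping p ∷ keeping y ∷ keeping m ∷ keeping a ∷ moving→ (just b) ∷ [] ,
          simulate as)
  -- The final simulation is not timed: nothing bounds the running time of the program with
  -- substituted bits.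
  δ (true , sim q) (p ∷ y ∷ m ∷ a ∷ z ∷ []) us with U.δ q us
  ... | nothing = nothing
  ... | just (q′ , as) =
    just ((true , sim q′) , keeping p ∷ keeping y ∷ keeping m ∷ keeping a ∷ keeping z ∷ [] , simulate as)
  -- Comparing spends the clock too, so the part of Z behind its head keeps bounding the tapes of
  -- `U` when the output head moves.
  δ (f , cmp) (p ∷ y ∷ m ∷ a ∷ blank ∷ []) us =
    just ((false , rewY) , keeping p ∷ moving← y ∷ keeping m ∷ keeping a ∷ keeping blank ∷ [] , idle)
  δ (f , cmp) (p ∷ y ∷ m ∷ a ∷ just b ∷ []) (i ∷ o ∷ us) with judge o y
  ... | just verdict =
    just ((verdict , rewY) , keeping p ∷ moving← y ∷ keeping m ∷ keeping a ∷ keeping (just b) ∷ [] , idle)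
  ... | nothing =
    just ((f , cmp) , keeping p ∷ moving→ y ∷ keeping m ∷ keeping a ∷ moving→ (just b) ∷ [] ,
          onOutput (moving→ o))
  δ (f , rewY) (p ∷ just c ∷ m ∷ a ∷ z ∷ []) us =
    just ((f , rewY) , keeping p ∷ moving← (just c) ∷ keeping m ∷ keeping a ∷ keeping z ∷ [] , idle)
  δ (f , rewY) (p ∷ blank ∷ m ∷ a ∷ z ∷ []) us =
    just ((f , wipe₁) , keeping p ∷ moving→ blank ∷ keeping m ∷ keeping a ∷ moving← z ∷ [] , idle)
  δ (f , wipe₁) (p ∷ y ∷ m ∷ a ∷ just b ∷ []) us =
    just ((f , wipe₁) , keeping p ∷ keeping y ∷ keeping m ∷ keeping a ∷ moving← (just b) ∷ [] , wipe right)
  δ (f , wipe₁) (p ∷ y ∷ m ∷ a ∷ blank ∷ []) us =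
    just ((f , wipe₂) , keeping p ∷ keeping y ∷ keeping m ∷ keeping a ∷ moving→ blank ∷ [] , wipe right)
  δ (f , wipe₂) (p ∷ y ∷ m ∷ a ∷ just b ∷ []) us =
    just ((f , wipe₂) , keeping p ∷ keeping y ∷ keeping m ∷ keeping a ∷ moving→ (just b) ∷ [] , wipe left)
  δ (f , wipe₂) (p ∷ y ∷ m ∷ a ∷ blank ∷ []) us =
    just ((f , wipe₃) , keeping p ∷ keeping y ∷ keeping m ∷ keeping a ∷ moving← blank ∷ [] , wipe left)
  δ (f , wipe₃) (p ∷ y ∷ m ∷ a ∷ just b ∷ []) us =
    just ((f , wipe₃) , keeping p ∷ keeping y ∷ keeping m ∷ keeping a ∷ moving← (just b) ∷ [] , wipe left)
  δ (f , wipe₃) (p ∷ y ∷ m ∷ a ∷ blank ∷ []) us =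
    just ((f , (if f then loadP else inc)) ,
          keeping p ∷ keeping y ∷ keeping m ∷ keeping a ∷ moving→ blank ∷ [] , wipe left)
  δ (f , inc) (p ∷ y ∷ m ∷ a ∷ just true ∷ []) us =
    just ((f , inc) , keeping p ∷ keeping y ∷ keeping m ∷ keeping a ∷ (just false , right) ∷ [] , idle)
  δ (f , inc) (p ∷ y ∷ m ∷ a ∷ just false ∷ []) us =
    just ((f , rewZ) , keeping p ∷ keeping y ∷ keeping m ∷ keeping a ∷ (just true , left) ∷ [] , idle)
  δ (f , inc) (p ∷ y ∷ m ∷ a ∷ blank ∷ []) us =
    just ((f , rewZ) , keeping p ∷ keeping y ∷ keeping m ∷ keeping a ∷ (just true , left) ∷ [] , idle)
  δ (f , rewZ) (p ∷ y ∷ m ∷ a ∷ just b ∷ []) us =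
    just ((f , rewZ) , keeping p ∷ keeping y ∷ keeping m ∷ keeping a ∷ moving← (just b) ∷ [] , idle)
  δ (f , rewZ) (p ∷ y ∷ m ∷ a ∷ blank ∷ []) us =
    just ((f , loadP) , keeping p ∷ keeping y ∷ keeping m ∷ keeping a ∷ moving→ blank ∷ [] , idle)
  δ _ _ _ = nothing

  merge : ∀ {A : Set} → Vec A 5 → Vec A U.tapes → Vec A (2 + suc (4 + U.workTapes))
  merge (p ∷ y ∷ m ∷ a ∷ z ∷ []) (i ∷ o ∷ us) = p ∷ y ∷ o ∷ m ∷ a ∷ z ∷ i ∷ us

  own : ∀ {A : Set} → Vec A (2 + suc (4 + U.workTapes)) → Vec A 5
  own (p ∷ y ∷ o ∷ m ∷ a ∷ z ∷ i ∷ us) = p ∷ y ∷ m ∷ a ∷ z ∷ []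

  simulated : ∀ {A : Set} → Vec A (2 + suc (4 + U.workTapes)) → Vec A U.tapes
  simulated (p ∷ y ∷ o ∷ m ∷ a ∷ z ∷ i ∷ us) = i ∷ o ∷ us

  decode : Fin (2 * (18 + U.states)) → State
  decode = Inverse.to stateCode

  encode : State → Fin (2 * (18 + U.states))
  encode = Inverse.from stateCode

  machine : TM 2
  machine = record
    { states    = 2 * (18 + U.states)
    ; workTapes = 4 + U.workTapes
    ; start     = encode (false , parse)
    ; δ         = λ q ss →
        Maybe.map (λ (s , as , u) → encode s , merge as (symbols u (simulated ss)))
                  (δ (decode q) (own ss) (simulated ss))
    }

  Conf : Set
  Conf = State × Vec Tape 5 × Vec Tape U.tapes

  advance : Conf → Maybe Conf
  advance (s , ts , us) =
    Maybe.map (λ (s′ , as , u) → s′ , zipWith put as ts , apply u us) (δ s (map head ts) (map head us))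

  module R = Run machine

  config : Conf → R.Config
  config (s , ts , us) = encode s , merge ts us

  zipWith-keeping : ∀ {n} (ts : Vec Tape n) → zipWith put (map keeping (map head ts)) ts ≡ ts
  zipWith-keeping []       = refl
  zipWith-keeping (t ∷ ts) = cong (t ∷_) (zipWith-keeping ts)

  zipWith-wipe : ∀ {n} m (ts : Vec Tape n) →
    zipWith put (map (λ _ → blank , m) (map head ts)) ts ≡ map (put (blank , m)) ts
  zipWith-wipe m []       = refl
  zipWith-wipe m (t ∷ ts) = cong (put (blank , m) t ∷_) (zipWith-wipe m ts)

  apply-symbols : ∀ u us → zipWith put (symbols u (map head us)) us ≡ apply u us
  apply-symbols idle          us           = zipWith-keeping us
  apply-symbols (wipe m)      us           = zipWith-wipe m us
  apply-symbols (onInput a)   (i ∷ us)     = cong (put a i ∷_) (zipWith-keeping us)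
  apply-symbols (onOutput a)  (i ∷ o ∷ us) = cong (λ us → i ∷ put a o ∷ us) (zipWith-keeping us)
  apply-symbols (simulate as) us           = refl

  zipWith-merge : ∀ as bs ts us →
    zipWith put (merge as bs) (merge ts us) ≡ merge (zipWith put as ts) (zipWith put bs us)
  zipWith-merge (_ ∷ _ ∷ _ ∷ _ ∷ _ ∷ []) (_ ∷ _ ∷ _) (_ ∷ _ ∷ _ ∷ _ ∷ _ ∷ []) (_ ∷ _ ∷ _) = refl

  own-merge : ∀ ts us → own (map head (merge ts us)) ≡ map head ts
  own-merge (_ ∷ _ ∷ _ ∷ _ ∷ _ ∷ []) (_ ∷ _ ∷ _) = refl

  simulated-merge : ∀ ts us → simulated (map head (merge ts us)) ≡ map head us
  simulated-merge (_ ∷ _ ∷ _ ∷ _ ∷ _ ∷ []) (_ ∷ _ ∷ _) = refl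

  step-config : ∀ c → R.stepᶜ (config c) ≡ Maybe.map config (advance c)
  step-config (s , ts , us)
    rewrite Inverse.strictlyInverseˡ stateCode s | own-merge ts us | simulated-merge ts us
    with δ s (map head ts) (map head us)
  ... | nothing            = refl
  ... | just (s′ , as , u) = cong (λ vs → just (encode s′ , vs))
    (trans (zipWith-merge as (symbols u (map head us)) ts us)
           (cong (merge (zipWith put as ts)) (apply-symbols u us)))

  infix 3 _⟶_ _⟶*_

  _⟶_ : Conf → Conf → Set
  c ⟶ d = advance c ≡ just d

  _⟶*_ : Conf → Conf → Set
  _⟶*_ = Star _⟶_

  ⟶*-halts : ∀ {c d} → c ⟶* d → advance d ≡ nothing → ∃[ s ] R.Halts s (config c) (config d)
  ⟶*-halts {c} ε       e = 0 , R.stop (trans (step-config c) (cong (Maybe.map config) e))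
  ⟶*-halts {c} (f ◅ r) e =
    let s , h = ⟶*-halts r e in suc s , R.more (trans (step-config c) (cong (Maybe.map config) f)) h

-- Runs of the searching machine

ones : ℕ → BitString
ones n = List.replicate n true

dbl : ℕ → ℕ → ℕ
dbl zero    w = w
dbl (suc v) w = dbl v (suc (suc w))

bit : Bool → ℕ → ℕ
bit true  v = suc v
bit false v = v

-- Numbers are coded in base 4, three bits per digit and a final 0: a code of
-- 3/2 log m bits, whereas 2 log m would exhaust the n² left by the pigeonhole.
header : List (Bool × Bool) → BitString → BitString
header []              r = false ∷ r
header ((b , b′) ∷ ds) r = true ∷ b ∷ b′ ∷ header ds r

value : ℕ → List (Bool × Bool) → ℕ
value v []              = v
value v ((b , b′) ∷ ds) = value (bit b′ (dbl (bit b (dbl v 0)) 0)) ds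

-- What loading `n` bits of the counter does both to the part of Z behind its head and to the input
-- tape of `U`.
fill : ℕ → BitString → BitString → BitString
fill zero    q z       = q
fill (suc n) q []      = fill n (false ∷ q) []
fill (suc n) q (b ∷ z) = fill n (b ∷ q) z

rest : ℕ → BitString → BitString
rest zero    z       = z
rest (suc n) []      = rest n []
rest (suc n) (b ∷ z) = rest n z

increment : BitString → BitString
increment []          = true ∷ []
increment (false ∷ z) = true ∷ z
increment (true  ∷ z) = false ∷ increment z

-- Tape extents and wiping

record Bounded (n : ℕ) (t : Tape) : Set where
  constructor _,_
  field
    before≤ : length (before t) ≤ n
    after≤  : length (after t) ≤ n

length-∷ᵇ : ∀ s l → length (s ∷ᵇ l) ≤ suc (length l)
length-∷ᵇ (just _) l       = ≤-refl
length-∷ᵇ blank    []      = z≤n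
length-∷ᵇ blank    (_ ∷ _) = ≤-refl

length-tl : ∀ l → length (tl l) ≤ length l
length-tl []      = z≤n
length-tl (_ ∷ l) = n≤1+n _

put-bounded : ∀ {n} a t → Bounded n t → Bounded (suc n) (put a t)
put-bounded (s , left)  (tape l _ r) (p , q) =
  ≤-trans (length-tl l) (m≤n⇒m≤1+n p) , ≤-trans (length-∷ᵇ s r) (s≤s q)
put-bounded (s , stay)  (tape l _ r) (p , q) = m≤n⇒m≤1+n p , m≤n⇒m≤1+n q
put-bounded (s , right) (tape l _ r) (p , q) =
  ≤-trans (length-∷ᵇ s l) (s≤s p) , ≤-trans (length-tl r) (m≤n⇒m≤1+n q)

zipWith-put-bounded : ∀ {n k} (as : Vec (Symbol × Move) k) {ts} →
  All (Bounded n) ts → All (Bounded (suc n)) (zipWith put as ts)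
zipWith-put-bounded []       []       = []
zipWith-put-bounded (a ∷ as) (b ∷ bs) = put-bounded a _ b ∷ zipWith-put-bounded as bs

bounded-suc : ∀ {n t} → Bounded n t → Bounded (suc n) t
bounded-suc (p , q) = m≤n⇒m≤1+n p , m≤n⇒m≤1+n q

all-bounded-suc : ∀ {n k} {ts : Vec Tape k} → All (Bounded n) ts → All (Bounded (suc n)) ts
all-bounded-suc []       = []
all-bounded-suc (b ∷ bs) = bounded-suc b ∷ all-bounded-suc bs

wipeTape : Move → ℕ → Tape → Tape
wipeTape m zero    t = t
wipeTape m (suc n) t = wipeTape m n (put (blank , m) t)

wipeTapes : ∀ {k} → Move → ℕ → Vec Tape k → Vec Tape k
wipeTapes m zero    ts = ts
wipeTapes m (suc n) ts = wipeTapes m n (map (put (blank , m)) ts)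

wipeTapes-∷ : ∀ {k} m n t (ts : Vec Tape k) → wipeTapes m n (t ∷ ts) ≡ wipeTape m n t ∷ wipeTapes m n ts
wipeTapes-∷ m zero    t ts = refl
wipeTapes-∷ m (suc n) t ts = wipeTapes-∷ m n _ _

wipeTapes-[] : ∀ m n → wipeTapes m n [] ≡ []
wipeTapes-[] m zero    = refl
wipeTapes-[] m (suc n) = wipeTapes-[] m n

wipeTapes-+ : ∀ {k} m a b (ts : Vec Tape k) → wipeTapes m b (wipeTapes m a ts) ≡ wipeTapes m (a + b) ts
wipeTapes-+ m zero    b ts = refl
wipeTapes-+ m (suc a) b ts = wipeTapes-+ m a b _

length-tl-pred : ∀ {n} l → length l ≤ suc n → length (tl l) ≤ n
length-tl-pred []      _       = z≤n
length-tl-pred (_ ∷ _) (s≤s p) = p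

wipe-right : ∀ n l h r → length r ≤ n →
  ∃[ l′ ] ∃[ h′ ] (wipeTape right n (tape l h r) ≡ tape l′ h′ [] × length l′ ≤ n + length l)
wipe-right zero    l h []      _ = l , h , refl , ≤-refl
wipe-right (suc n) l h r       p
  with l′ , h′ , e , q ← wipe-right n (blank ∷ᵇ l) (hd r) (tl r) (length-tl-pred r p) =
  l′ , h′ , e , ≤-trans q (≤-trans (+-monoʳ-≤ n (length-∷ᵇ blank l)) (≤-reflexive (+-suc n _)))

wipe-left : ∀ n l h → length l ≤ n → wipeTape left (suc n) (tape l h []) ≡ blankTape
wipe-left zero    []      h _       = refl
wipe-left (suc n) []      h _       = wipe-left n [] blank z≤n
wipe-left (suc n) (s ∷ l) h (s≤s p) = wipe-left n l s p

-- The sweep to the right empties the right halves and moves the head by `suc i`. Whatever is left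
-- then lies within `n + suc i` cells to the left, where the second sweep erases it.
wipe-all : ∀ {k n i j} (ts : Vec Tape k) → All (Bounded n) ts → n ≤ i → n + suc i ≤ j →
  wipeTapes left (suc j) (wipeTapes right (suc i) ts) ≡ replicate k blankTape
wipe-all {i = i} {j} []               []             p q =
  trans (cong (wipeTapes left (suc j)) (wipeTapes-[] right (suc i))) (wipeTapes-[] left (suc j))
wipe-all {n = n} {i} {j} (tape l h r ∷ ts) ((a , b) ∷ bs) p q
  with l′ , h′ , e , c ← wipe-right (suc i) l h r (≤-trans b (m≤n⇒m≤1+n p)) =
  trans (cong (wipeTapes left (suc j)) (wipeTapes-∷ right (suc i) (tape l h r) ts))
  (trans (wipeTapes-∷ left (suc j) (wipeTape right (suc i) (tape l h r)) _)
  (cong₂ _∷_ (trans (cong (wipeTape left (suc j)) e)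
                    (wipe-left j l′ h′ (≤-trans c (≤-trans (+-monoʳ-≤ (suc i) a)
                       (≤-trans (≤-reflexive (+-comm (suc i) n)) q)))))
             (wipe-all ts bs p q)))

bitsUntilBlank-hd-tl : ∀ r → bitsUntilBlank (hd r ∷ tl r) ≡ bitsUntilBlank r
bitsUntilBlank-hd-tl []      = refl
bitsUntilBlank-hd-tl (_ ∷ _) = refl

reverse² : ∀ (z : BitString) → (z ʳ++ []) ʳ++ [] ≡ z
reverse² z = trans (List.ʳ++-ʳ++ z) (List.++-identityʳ z)

-- The phases of the machine and a single trial

module Runs (U : TM 1) where
  open Search U public

  blanks : Vec Tape U.tapes
  blanks = replicate U.tapes blankTape

  dblA-run : ∀ v w {f P Y Z us} →
    ((f , dblA) , P ∷ Y ∷ at [] (ones v) ∷ leftOf [] (ones w) ∷ Z ∷ [] , us) ⟶*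
    ((f , bitA) , P ∷ Y ∷ blankTape ∷ leftOf [] (ones (dbl v w)) ∷ Z ∷ [] , us)
  dblA-run zero    w = refl ◅ ε
  dblA-run (suc v) w = refl ◅ refl ◅ dblA-run v (suc (suc w))

  dblM-run : ∀ v w {f P Y Z us} →
    ((f , dblM) , P ∷ Y ∷ leftOf [] (ones w) ∷ at [] (ones v) ∷ Z ∷ [] , us) ⟶*
    ((f , bitM) , P ∷ Y ∷ leftOf [] (ones (dbl v w)) ∷ blankTape ∷ Z ∷ [] , us)
  dblM-run zero    w = refl ◅ ε
  dblM-run (suc v) w = refl ◅ refl ◅ dblM-run v (suc (suc w))

  bitA-step : ∀ b v r {f Y Z us} →
    ((f , bitA) , at [] (b ∷ r) ∷ Y ∷ blankTape ∷ leftOf [] (ones v) ∷ Z ∷ [] , us) ⟶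
    ((f , dblM) , at [] r ∷ Y ∷ blankTape ∷ at [] (ones (bit b v)) ∷ Z ∷ [] , us)
  bitA-step true  v r = refl
  bitA-step false v r = refl

  bitM-step : ∀ b v r {f Y Z us} →
    ((f , bitM) , at [] (b ∷ r) ∷ Y ∷ leftOf [] (ones v) ∷ blankTape ∷ Z ∷ [] , us) ⟶
    ((f , parse) , at [] r ∷ Y ∷ leftOf [] (ones (bit b v)) ∷ blankTape ∷ Z ∷ [] , us)
  bitM-step true  v r = refl
  bitM-step false v r = refl

  parse-run : ∀ ds v r {f Y Z us} →
    ((f , parse) , at [] (header ds r) ∷ Y ∷ leftOf [] (ones v) ∷ blankTape ∷ Z ∷ [] , us) ⟶*
    ((f , loadP) , at [] r ∷ Y ∷ at [] (ones (value v ds)) ∷ blankTape ∷ Z ∷ [] , us)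
  parse-run []              v r = refl ◅ ε
  parse-run ((b , b′) ∷ ds) v r =
    refl ◅ (dblA-run v 0 ◅◅ (bitA-step b (dbl v 0) (b′ ∷ header ds r) ◅
      (dblM-run (bit b (dbl v 0)) 0 ◅◅
        (bitM-step b′ (dbl (bit b (dbl v 0)) 0) (header ds r) ◅ parse-run ds _ r))))

  loadP-run : ∀ f r lp l z q {Y M A us} →
    ((f , loadP) , at lp r ∷ Y ∷ M ∷ A ∷ at l z ∷ [] , leftOf [] q ∷ us) ⟶*
    ((f , loadM) , at (r ʳ++ lp) [] ∷ Y ∷ M ∷ A ∷ at (fill (length r) l z) (rest (length r) z) ∷ [] ,
     leftOf [] (if f then r ʳ++ q else fill (length r) q z) ∷ us)
  loadP-run true  []      lp l z       q = refl ◅ ε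
  loadP-run false []      lp l z       q = refl ◅ ε
  loadP-run true  (c ∷ r) lp l []      q = refl ◅ loadP-run true r (c ∷ lp) (false ∷ l) [] (c ∷ q)
  loadP-run true  (c ∷ r) lp l (b ∷ z) q = refl ◅ loadP-run true r (c ∷ lp) (b ∷ l) z (c ∷ q)
  loadP-run false (c ∷ r) lp l []      q = refl ◅ loadP-run false r (c ∷ lp) (false ∷ l) [] (false ∷ q)
  loadP-run false (c ∷ r) lp l (b ∷ z) q = refl ◅ loadP-run false r (c ∷ lp) (b ∷ l) z (b ∷ q)

  loadM-run : ∀ m lm l z q {f P Y A us} →
    ((f , loadM) , P ∷ Y ∷ at lm m ∷ A ∷ at l z ∷ [] , leftOf [] q ∷ us) ⟶*
    ((f , loadM) , P ∷ Y ∷ at (m ʳ++ lm) [] ∷ A ∷ at (fill (length m) l z) (rest (length m) z) ∷ [] ,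
     leftOf [] (fill (length m) q z) ∷ us)
  loadM-run []      lm l z       q = ε
  loadM-run (c ∷ m) lm l []      q = refl ◅ loadM-run m (c ∷ lm) (false ∷ l) [] (false ∷ q)
  loadM-run (c ∷ m) lm l (b ∷ z) q = refl ◅ loadM-run m (c ∷ lm) (b ∷ l) z (b ∷ q)

  rewM-run : ∀ l m {f P Y A Z us} →
    ((f , rewM) , P ∷ Y ∷ leftOf l m ∷ A ∷ Z ∷ [] , us) ⟶*
    ((f , rewP) , P ∷ Y ∷ at [] (l ʳ++ m) ∷ A ∷ Z ∷ [] , us)
  rewM-run []      m = refl ◅ ε
  rewM-run (b ∷ l) m {f} {P} {Y} {A} {Z} {us} =
    cong (λ t → just ((f , rewM) , P ∷ Y ∷ t ∷ A ∷ Z ∷ [] , us)) (shift-left l (b ∷ m))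
    ◅ rewM-run l (b ∷ m)

  rewP-run : ∀ l p {f Y M A Z us} →
    ((f , rewP) , leftOf l p ∷ Y ∷ M ∷ A ∷ Z ∷ [] , us) ⟶*
    ((f , sim U.start) , at [] (l ʳ++ p) ∷ Y ∷ M ∷ A ∷ Z ∷ [] , us)
  rewP-run []      p = refl ◅ ε
  rewP-run (b ∷ l) p {f} {Y} {M} {A} {Z} {us} =
    cong (λ t → just ((f , rewP) , t ∷ Y ∷ M ∷ A ∷ Z ∷ [] , us)) (shift-left l (b ∷ p))
    ◅ rewP-run l (b ∷ p)

  -- Later loads land further left on the input tape, so the bits counted off by M form the prefix
  -- and those counted off by P the remainder.
  program : Bool → BitString → ℕ → BitString → BitString
  program f r μ z =
    fill μ (if f then r ʳ++ [] else fill (length r) [] z) (rest (length r) z)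

  load-run : ∀ f r m z {Y A us} →
    ((f , loadP) , at [] r ∷ Y ∷ at [] m ∷ A ∷ at [] z ∷ [] , blankTape ∷ us) ⟶*
    ((f , sim U.start) , at [] r ∷ Y ∷ at [] m ∷ A ∷
     at (program false r (length m) z) (rest (length m) (rest (length r) z)) ∷ [] ,
     at [] (program f r (length m) z) ∷ us)
  load-run f r m z {Y} {A} {us} =
    loadP-run f r [] [] z [] ◅◅
    (loadM-run m [] (fill (length r) [] z) (rest (length r) z) _ ◅◅
    (cong₂ (λ p t → just ((f , rewM) , p ∷ Y ∷ t ∷ A ∷ Z ∷ [] , I ∷ us))
           (shift-left (r ʳ++ []) []) (shift-left (m ʳ++ []) []) ◅
    subst₂ (λ p t → ((f , rewM) , leftOf (r ʳ++ []) [] ∷ Y ∷ leftOf (m ʳ++ []) [] ∷ A ∷ Z ∷ [] , I ∷ us) ⟶*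
                    ((f , sim U.start) , at [] p ∷ Y ∷ at [] t ∷ A ∷ Z ∷ [] , I ∷ us))
           (reverse² r) (reverse² m)
           (rewM-run (m ʳ++ []) [] ◅◅ rewP-run (r ʳ++ []) [])))
    where
    Z = at (program false r (length m) z) (rest (length m) (rest (length r) z))
    I = at [] (program f r (length m) z)

  rewY-run : ∀ ly y {f P M A l z us} →
    ((f , rewY) , P ∷ leftOf ly y ∷ M ∷ A ∷ at l z ∷ [] , us) ⟶*
    ((f , wipe₁) , P ∷ at [] (ly ʳ++ y) ∷ M ∷ A ∷ leftOf l z ∷ [] , us)
  rewY-run []       y {f} {P} {M} {A} {l} {z} {us} =
    cong (λ t → just ((f , wipe₁) , P ∷ at [] y ∷ M ∷ A ∷ t ∷ [] , us)) (shift-left l z) ◅ ε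
  rewY-run (b ∷ ly) y {f} {P} {M} {A} {l} {z} {us} =
    cong (λ t → just ((f , rewY) , P ∷ t ∷ M ∷ A ∷ at l z ∷ [] , us)) (shift-left ly (b ∷ y))
    ◅ rewY-run ly (b ∷ y)

  wipe₁-run : ∀ l z {f P Y M A us} →
    ((f , wipe₁) , P ∷ Y ∷ M ∷ A ∷ leftOf l z ∷ [] , us) ⟶*
    ((f , wipe₂) , P ∷ Y ∷ M ∷ A ∷ at [] (l ʳ++ z) ∷ [] , wipeTapes right (suc (length l)) us)
  wipe₁-run []      z = refl ◅ ε
  wipe₁-run (b ∷ l) z {f} {P} {Y} {M} {A} {us} =
    cong (λ t → just ((f , wipe₁) , P ∷ Y ∷ M ∷ A ∷ t ∷ [] , map (put (blank , right)) us))
         (shift-left l (b ∷ z)) ◅ wipe₁-run l (b ∷ z)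

  wipe₂-run : ∀ z l {f P Y M A us} →
    ((f , wipe₂) , P ∷ Y ∷ M ∷ A ∷ at l z ∷ [] , us) ⟶*
    ((f , wipe₃) , P ∷ Y ∷ M ∷ A ∷ leftOf (z ʳ++ l) [] ∷ [] , wipeTapes left (suc (length z)) us)
  wipe₂-run []      l {f} {P} {Y} {M} {A} {us} =
    cong (λ t → just ((f , wipe₃) , P ∷ Y ∷ M ∷ A ∷ t ∷ [] , map (put (blank , left)) us))
         (shift-left l []) ◅ ε
  wipe₂-run (b ∷ z) l = refl ◅ wipe₂-run z (b ∷ l)

  wipe₃-run : ∀ l z {f P Y M A us} →
    ((f , wipe₃) , P ∷ Y ∷ M ∷ A ∷ leftOf l z ∷ [] , us) ⟶*
    ((f , (if f then loadP else inc)) , P ∷ Y ∷ M ∷ A ∷ at [] (l ʳ++ z) ∷ [] ,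
     wipeTapes left (suc (length l)) us)
  wipe₃-run []      z = refl ◅ ε
  wipe₃-run (b ∷ l) z {f} {P} {Y} {M} {A} {us} =
    cong (λ t → just ((f , wipe₃) , P ∷ Y ∷ M ∷ A ∷ t ∷ [] , map (put (blank , left)) us))
         (shift-left l (b ∷ z)) ◅ wipe₃-run l (b ∷ z)

  cleanup-run : ∀ {f P M A us} ly y l z → All (Bounded (length l)) us →
    ((f , rewY) , P ∷ leftOf ly y ∷ M ∷ A ∷ at l z ∷ [] , us) ⟶*
    ((f , (if f then loadP else inc)) , P ∷ at [] (ly ʳ++ y) ∷ M ∷ A ∷ at [] (l ʳ++ z) ∷ [] , blanks)
  cleanup-run {f} {P} {M} {A} {us} ly y l z b =
    rewY-run ly y ◅◅ (wipe₁-run l z ◅◅ (wipe₂-run w [] ◅◅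
    subst₂ (λ w′ us′ →
        ((f , wipe₃) , P ∷ at [] (ly ʳ++ y) ∷ M ∷ A ∷ leftOf (w ʳ++ []) [] ∷ [] , vs) ⟶*
        ((f , (if f then loadP else inc)) , P ∷ at [] (ly ʳ++ y) ∷ M ∷ A ∷ at [] w′ ∷ [] , us′))
      (reverse² w) wiped (wipe₃-run (w ʳ++ []) [])))
    where
    w = l ʳ++ z
    vs = wipeTapes left (suc (length w)) (wipeTapes right (suc (length l)) us)
    l≤w : length l ≤ length w
    l≤w = ≤-trans (m≤m+n _ _) (≤-reflexive (sym (List.length-ʳ++ l)))
    ∣w∣ : length (w ʳ++ []) ≡ length w
    ∣w∣ = trans (List.length-ʳ++ w) (+-identityʳ _)
    -- Both `wipe₂` and `wipe₃` sweep left along all of Z. Since `w` is at least as long as `l`,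
    -- their joint length covers the sweep to the right and the original left halves.
    wiped : wipeTapes left (suc (length (w ʳ++ []))) vs ≡ blanks
    wiped = trans (cong (λ n → wipeTapes left (suc n) vs) ∣w∣)
      (trans (wipeTapes-+ left (suc (length w)) (suc (length w)) _)
             (wipe-all us b ≤-refl (+-mono-≤ l≤w (s≤s l≤w))))

  rewZ-run : ∀ l z {f P Y M A us} →
    ((f , rewZ) , P ∷ Y ∷ M ∷ A ∷ leftOf l z ∷ [] , us) ⟶*
    ((f , loadP) , P ∷ Y ∷ M ∷ A ∷ at [] (l ʳ++ z) ∷ [] , us)
  rewZ-run []      z = refl ◅ ε
  rewZ-run (b ∷ l) z {f} {P} {Y} {M} {A} {us} =
    cong (λ t → just ((f , rewZ) , P ∷ Y ∷ M ∷ A ∷ t ∷ [] , us))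
         (shift-left l (b ∷ z)) ◅ rewZ-run l (b ∷ z)

  inc-run : ∀ z l {f P Y M A us} →
    ((f , inc) , P ∷ Y ∷ M ∷ A ∷ at l z ∷ [] , us) ⟶*
    ((f , loadP) , P ∷ Y ∷ M ∷ A ∷ at [] (l ʳ++ increment z) ∷ [] , us)
  inc-run []          l {f} {P} {Y} {M} {A} {us} =
    cong (λ t → just ((f , rewZ) , P ∷ Y ∷ M ∷ A ∷ t ∷ [] , us)) (shift-left l (true ∷ [])) ◅ rewZ-run l _
  inc-run (false ∷ z) l {f} {P} {Y} {M} {A} {us} =
    cong (λ t → just ((f , rewZ) , P ∷ Y ∷ M ∷ A ∷ t ∷ [] , us)) (shift-left l (true ∷ z)) ◅ rewZ-run l _
  inc-run (true ∷ z)  l = refl ◅ inc-run z (false ∷ l)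

  module Test (M A : Tape) where

    -- The outcome of a trial, with the run quantified over the program tape: the verdict cannot
    -- depend on the bits that are to be substituted.
    record Judged (verdict : Bool) (c : Tape → Conf) (y z : BitString) : Set where
      constructor judged
      field
        {l zs ly ys} : BitString
        {us}         : Vec Tape U.tapes
        bounded      : All (Bounded (length l)) us
        joinZ        : l ʳ++ zs ≡ z
        joinY        : ly ʳ++ ys ≡ y
        run          : ∀ P → c P ⟶* ((verdict , rewY) , P ∷ leftOf ly ys ∷ M ∷ A ∷ at l zs ∷ [] , us)

    prepend : ∀ {v c c′ y z} → (∀ P → c P ⟶ c′ P) → Judged v c′ y z → Judged v c y z
    prepend s (judged b eZ eY r) = judged b eZ eY (λ P → s P ◅ r P)

    finish : ∀ l z ly y {v c us} → All (Bounded (length l)) us →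
      (∀ P → c P ⟶ ((v , rewY) , P ∷ shift left (at ly y) ∷ M ∷ A ∷ at l z ∷ [] , us)) →
      Judged v c (ly ʳ++ y) (l ʳ++ z)
    finish l z ly y {v} {c} {us} b s = judged b refl refl (λ P →
      subst (λ t → c P ⟶ ((v , rewY) , P ∷ t ∷ M ∷ A ∷ at l z ∷ [] , us)) (shift-left ly y) (s P) ◅ ε)

    compareFrom : BitString → BitString → BitString → BitString → Vec Tape U.tapes → Tape → Conf
    compareFrom ly y l z us P = (false , cmp) , P ∷ at ly y ∷ M ∷ A ∷ at l z ∷ [] , us

    -- A negative verdict does not show that the output is wrong, since the clock may have run out.
    -- It only shows that the clock was too short for a correct output.
    compare : ∀ y ly z l i o us → All (Bounded (length l)) (i ∷ o ∷ us) →
      (contents o ≡ y × Judged true (compareFrom ly y l z (i ∷ o ∷ us)) (ly ʳ++ y) (l ʳ++ z)) ⊎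
      ((contents o ≡ y → length z ≤ length y) ×
       Judged false (compareFrom ly y l z (i ∷ o ∷ us)) (ly ʳ++ y) (l ʳ++ z))
    compare y           ly []      l i o                      us b =
      inj₂ ((λ _ → z≤n) , finish l [] ly y b (λ _ → refl))
    compare []          ly (c ∷ z) l i (tape _ blank _)       us b =
      inj₁ (refl , finish l (c ∷ z) ly [] b (λ _ → refl))
    compare []          ly (c ∷ z) l i (tape _ (just true) _) us b =
      inj₂ ((λ ()) , finish l (c ∷ z) ly [] b (λ _ → refl))
    compare []          ly (c ∷ z) l i (tape _ (just false) _) us b =
      inj₂ ((λ ()) , finish l (c ∷ z) ly [] b (λ _ → refl))
    compare (true ∷ y)  ly (c ∷ z) l i (tape _ blank _)       us b =
      inj₂ ((λ ()) , finish l (c ∷ z) ly (true ∷ y) b (λ _ → refl))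
    compare (false ∷ y) ly (c ∷ z) l i (tape _ blank _)       us b =
      inj₂ ((λ ()) , finish l (c ∷ z) ly (false ∷ y) b (λ _ → refl))
    compare (true ∷ y)  ly (c ∷ z) l i (tape _ (just false) _) us b =
      inj₂ ((λ ()) , finish l (c ∷ z) ly (true ∷ y) b (λ _ → refl))
    compare (false ∷ y) ly (c ∷ z) l i (tape _ (just true) _) us b =
      inj₂ ((λ ()) , finish l (c ∷ z) ly (false ∷ y) b (λ _ → refl))
    compare (true ∷ y)  ly (c ∷ z) l i o@(tape _ (just true) r) us (bi ∷ bo ∷ bs)
      with compare y (true ∷ ly) z (c ∷ l) i (put (just true , right) o) us
             (bounded-suc bi ∷ put-bounded (just true , right) o bo ∷ all-bounded-suc bs)
    ... | inj₁ (e , j) = inj₁ (cong (true ∷_) (trans (sym (bitsUntilBlank-hd-tl r)) e) ,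
                               prepend (λ _ → refl) j)
    ... | inj₂ (n , j) = inj₂ ((λ e → s≤s (n (trans (bitsUntilBlank-hd-tl r) (List.∷-injectiveʳ e)))) ,
                               prepend (λ _ → refl) j)
    compare (false ∷ y) ly (c ∷ z) l i o@(tape _ (just false) r) us (bi ∷ bo ∷ bs)
      with compare y (false ∷ ly) z (c ∷ l) i (put (just false , right) o) us
             (bounded-suc bi ∷ put-bounded (just false , right) o bo ∷ all-bounded-suc bs)
    ... | inj₁ (e , j) = inj₁ (cong (false ∷_) (trans (sym (bitsUntilBlank-hd-tl r)) e) ,
                               prepend (λ _ → refl) j)
    ... | inj₂ (n , j) = inj₂ ((λ e → s≤s (n (trans (bitsUntilBlank-hd-tl r) (List.∷-injectiveʳ e)))) ,
                               prepend (λ _ → refl) j)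

    simulateFrom : BitString → BitString → BitString → U.Config → Tape → Conf
    simulateFrom y l z (q , us) P = (false , sim q) , P ∷ at [] y ∷ M ∷ A ∷ at l z ∷ [] , us

    sim-stop : ∀ {y l b z q us} → U.δ q (map head us) ≡ nothing → ∀ P →
      simulateFrom y l (b ∷ z) (q , us) P ⟶ compareFrom [] y l (b ∷ z) us P
    sim-stop e P rewrite e = refl

    sim-step : ∀ {y l b z q us q′ as} → U.δ q (map head us) ≡ just (q′ , as) → ∀ P →
      simulateFrom y l (b ∷ z) (q , us) P ⟶ simulateFrom y (b ∷ l) z (q′ , zipWith put as us) P
    sim-step e P rewrite e = refl

    -- As in `compare`, failure yields only a bound on the clock: one cell per simulated step and
    -- one per compared bit. Success yields an actual computation of `y`.
    test : ∀ y z l q us → All (Bounded (length l)) us →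
      ((∃[ s ] ∃[ d ] (U.Halts s (q , us) d × U.output d ≡ y)) ×
       Judged true (simulateFrom y l z (q , us)) y (l ʳ++ z)) ⊎
      ((∀ {s d} → U.Halts s (q , us) d → U.output d ≡ y → length z ≤ s + length y) ×
       Judged false (simulateFrom y l z (q , us)) y (l ʳ++ z))
    test y []      l q us b = inj₂ ((λ _ _ → z≤n) , finish l [] [] y b (λ _ → refl))
    test y (c ∷ z) l q us b with U.δ q (map head us) in eq
    test y (c ∷ z) l q us@(i ∷ o ∷ ws) b | nothing with compare y [] (c ∷ z) l i o ws b
    ... | inj₁ (e , j) =
      inj₁ ((0 , (q , us) , U.stop (U.stepᶜ-nothing eq) , e) , prepend (sim-stop {y} eq) j)
    ... | inj₂ (n , j) = inj₂ (late , prepend (sim-stop {y} eq) j)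
      where
      late : ∀ {s d} → U.Halts s (q , us) d → U.output d ≡ y → suc (length z) ≤ s + length y
      late (U.stop _)   e = n e
      late (U.more f _) _ with () ← trans (sym f) (U.stepᶜ-nothing eq)
    test y (c ∷ z) l q us b | just (q′ , as)
      with test y z (c ∷ l) q′ (zipWith put as us) (zipWith-put-bounded as b)
    ... | inj₁ ((s , d , h , e) , j) =
      inj₁ ((suc s , d , U.more (U.stepᶜ-just eq) h , e) , prepend (sim-step {y} eq) j)
    ... | inj₂ (n , j) = inj₂ (late , prepend (sim-step {y} eq) j)
      where
      late : ∀ {s d} → U.Halts s (q , us) d → U.output d ≡ y → suc (length z) ≤ s + length y
      late (U.stop f)   _ with () ← trans (sym f) (U.stepᶜ-just eq)
      late (U.more f h) e with refl ← just-injective (trans (sym f) (U.stepᶜ-just eq)) = s≤s (n h e)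

  free-run : ∀ {s c d ts} → U.Halts s c d →
    ((true , sim (proj₁ c)) , ts , proj₂ c) ⟶* ((true , sim (proj₁ d)) , ts , proj₂ d) ×
    advance ((true , sim (proj₁ d)) , ts , proj₂ d) ≡ nothing
  free-run {c = q , us} {ts = _ ∷ _ ∷ _ ∷ _ ∷ _ ∷ []} (U.stop e) = ε , halt e
    where
    halt : ∀ {P Y M A Z} → U.stepᶜ (q , us) ≡ nothing →
      advance ((true , sim q) , P ∷ Y ∷ M ∷ A ∷ Z ∷ [] , us) ≡ nothing
    halt e with U.δ q (map head us)
    ... | nothing = refl
  free-run {c = q , us} {ts = _ ∷ _ ∷ _ ∷ _ ∷ _ ∷ []} (U.more {c′ = c′} e h) =
    let r , n = free-run h in step e ◅ r , n
    where
    step : ∀ {P Y M A Z} → U.stepᶜ (q , us) ≡ just c′ →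
      ((true , sim q) , P ∷ Y ∷ M ∷ A ∷ Z ∷ [] , us) ⟶
      ((true , sim (proj₁ c′)) , P ∷ Y ∷ M ∷ A ∷ Z ∷ [] , proj₂ c′)
    step e with U.δ q (map head us)
    step refl | just (q′ , as) = refl

-- The search for a program

fill-++ : ∀ n q w z → fill n (q List.++ w) z ≡ fill n q z List.++ w
fill-++ zero    q w z       = refl
fill-++ (suc n) q w []      = fill-++ n (false ∷ q) w []
fill-++ (suc n) q w (b ∷ z) = fill-++ n (b ∷ q) w z

fill-+ : ∀ a b q z → fill b (fill a q z) (rest a z) ≡ fill (a + b) q z
fill-+ zero    b q z       = refl
fill-+ (suc a) b q []      = fill-+ a b (false ∷ q) []
fill-+ (suc a) b q (c ∷ z) = fill-+ a b (c ∷ q) z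

rest-+ : ∀ a b z → rest b (rest a z) ≡ rest (a + b) z
rest-+ zero    b z       = refl
rest-+ (suc a) b []      = rest-+ a b []
rest-+ (suc a) b (c ∷ z) = rest-+ a b z

length-fill : ∀ n q z → length (fill n q z) ≡ n + length q
length-fill zero    q z       = refl
length-fill (suc n) q []      = trans (length-fill n (false ∷ q) []) (+-suc n _)
length-fill (suc n) q (b ∷ z) = trans (length-fill n (b ∷ q) z) (+-suc n _)

fill-ʳ++ : ∀ l n u → fill (length l + n) [] (l ʳ++ u) ≡ fill n l u
fill-ʳ++ []      n u = refl
fill-ʳ++ (b ∷ l) n u =
  trans (cong (λ k → fill k [] (l ʳ++ (b ∷ u))) (sym (+-suc (length l) n))) (fill-ʳ++ l (suc n) (b ∷ u))

rest-ʳ++ : ∀ l n u → rest (length l + n) (l ʳ++ u) ≡ rest n u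
rest-ʳ++ []      n u = refl
rest-ʳ++ (b ∷ l) n u =
  trans (cong (λ k → rest k (l ʳ++ (b ∷ u))) (sym (+-suc (length l) n))) (rest-ʳ++ l (suc n) (b ∷ u))

fill-ʳ++-rest : ∀ n l z → n ≤ length z → fill n l z ʳ++ rest n z ≡ l ʳ++ z
fill-ʳ++-rest zero    l z       _       = refl
fill-ʳ++-rest (suc n) l (b ∷ z) (s≤s p) = fill-ʳ++-rest n (b ∷ l) z p

zeros : ℕ → BitString
zeros n = List.replicate n false

fill-ʳ++-rest-[] : ∀ n l → fill n l [] ʳ++ rest n [] ≡ l ʳ++ zeros n
fill-ʳ++-rest-[] zero    l = refl
fill-ʳ++-rest-[] (suc n) l = fill-ʳ++-rest-[] n (false ∷ l)

length-increment : ∀ z → length z ≤ length (increment z)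
length-increment []          = z≤n
length-increment (false ∷ z) = ≤-refl
length-increment (true ∷ z)  = s≤s (length-increment z)

_↝*_ : BitString → BitString → Set
_↝*_ = Star (λ z z′ → increment z ≡ z′)

-- The lowest bit comes first, so two increments with a leading `false` amount to one increment of
-- the tail.
↝*-false∷ : ∀ {z z′} → z ↝* z′ → (false ∷ z) ↝* (false ∷ z′)
↝*-false∷ ε          = ε
↝*-false∷ (refl ◅ p) = refl ◅ refl ◅ ↝*-false∷ p

↝*-zeros++ : ∀ n {z z′} → z ↝* z′ → (zeros n List.++ z) ↝* (zeros n List.++ z′)
↝*-zeros++ zero    p = p
↝*-zeros++ (suc n) p = ↝*-false∷ (↝*-zeros++ n p)

↝*-fromZeros : ∀ w u → (zeros (length w) List.++ u) ↝* (w List.++ u)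
↝*-fromZeros []          u = ε
↝*-fromZeros (false ∷ w) u = ↝*-false∷ (↝*-fromZeros w u)
↝*-fromZeros (true ∷ w)  u = ↝*-false∷ (↝*-fromZeros w u) ◅◅ (refl ◅ ε)

powerOfTwo : ℕ → BitString
powerOfTwo n = zeros n List.++ (true ∷ [])

↝*-powerOfTwo : ∀ n → (true ∷ []) ↝* powerOfTwo n
↝*-powerOfTwo zero    = ε
↝*-powerOfTwo (suc n) = refl ◅ ↝*-false∷ (↝*-powerOfTwo n)

length-powerOfTwo : ∀ n → length (powerOfTwo n) ≡ suc n
length-powerOfTwo zero    = refl
length-powerOfTwo (suc n) = cong suc (length-powerOfTwo n)

-- The high bits are counted up to `powerOfTwo n` over a zero candidate, then the low bits up to the
-- reversal of `p`. Hence each candidate occurs with arbitrarily long clocks.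
↝*-reach : ∀ p n → zeros (length p) ↝* (p ʳ++ powerOfTwo n)
↝*-reach p n = subst₂ _↝*_ (List.++-identityʳ _) (sym (List.ʳ++-defn p))
  (↝*-zeros++ (length p) (refl ◅ ↝*-powerOfTwo n) ◅◅
   subst (λ k → (zeros k List.++ powerOfTwo n) ↝* (List.reverse p List.++ powerOfTwo n))
         (List.length-reverse p) (↝*-fromZeros (List.reverse p) (powerOfTwo n)))

module Find (U : TM 1) where
  open Runs U public

  module Loop (ρ : ℕ) (m y : BitString) where

    k : ℕ
    k = ρ + length m

    candidate padding pad : BitString → BitString
    candidate z = fill k [] z
    padding z   = rest k z
    pad z       = candidate z ʳ++ padding z

    length-candidate : ∀ z → length (candidate z) ≡ k
    length-candidate z = trans (length-fill k [] z) (+-identityʳ k)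

    candidate-join : ∀ p u → length p ≡ k → candidate (p ʳ++ u) ≡ p
    candidate-join p u e =
      trans (cong (λ n → fill n [] (p ʳ++ u)) (trans (sym e) (sym (+-identityʳ _)))) (fill-ʳ++ p 0 u)

    padding-join : ∀ p u → length p ≡ k → padding (p ʳ++ u) ≡ u
    padding-join p u e =
      trans (cong (λ n → rest n (p ʳ++ u)) (trans (sym e) (sym (+-identityʳ _)))) (rest-ʳ++ p 0 u)

    own-tapes : BitString → BitString → Vec Tape 5
    own-tapes r z = at [] r ∷ at [] y ∷ at [] m ∷ blankTape ∷ at [] z ∷ []

    loop found : BitString → BitString → Conf
    loop r z  = (false , loadP) , own-tapes r z , blanks
    found r z = (true , loadP) , own-tapes r z , blanks

    open Test (at [] m) blankTape

    load-candidate : ∀ r z → length r ≡ ρ →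
      loop r z ⟶* simulateFrom y (candidate z) (padding z) (U.initialᶜ (candidate z ∷ [])) (at [] r)
    load-candidate r z e = subst₂ (λ p u → loop r z ⟶* simulateFrom y p u (U.initialᶜ (p ∷ [])) (at [] r))
      (trans (fill-+ (length r) (length m) [] z) (cong (λ n → fill (n + length m) [] z) e))
      (trans (rest-+ (length r) (length m) z) (cong (λ n → rest (n + length m) z) e))
      (load-run false r m z)

    blanks-bounded : ∀ {n} j → All (Bounded n) (replicate j blankTape)
    blanks-bounded zero    = []
    blanks-bounded (suc j) = (z≤n , z≤n) ∷ blanks-bounded j

    initial-bounded : ∀ p → All (Bounded (length p)) (proj₂ (U.initialᶜ (p ∷ [])))
    initial-bounded p = (z≤n , after≤ p) ∷ blanks-bounded _
      where
      length-map : ∀ q → length (List.map {B = Symbol} just q) ≤ length q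
      length-map []      = z≤n
      length-map (b ∷ q) = s≤s (length-map q)
      after≤ : ∀ p → length (tl (List.map just p)) ≤ length p
      after≤ []      = z≤n
      after≤ (b ∷ p) = m≤n⇒m≤1+n (length-map p)

    complete : ∀ {v z} →
      Judged v (simulateFrom y (candidate z) (padding z) (U.initialᶜ (candidate z ∷ []))) y (pad z) →
      ∀ r → length r ≡ ρ →
      loop r z ⟶* ((v , (if v then loadP else inc)) , own-tapes r (pad z) , blanks)
    complete {v} {z} (judged {l} {zs} {ly} {ys} b eZ eY run) r e =
      load-candidate r z e ◅◅ (run (at [] r) ◅◅
      subst₂ (λ z′ y′ → ((v , rewY) , at [] r ∷ leftOf ly ys ∷ at [] m ∷ blankTape ∷ at l zs ∷ [] , _) ⟶*
                        ((v , (if v then loadP else inc)) ,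
                         at [] r ∷ at [] y′ ∷ at [] m ∷ blankTape ∷ at [] z′ ∷ [] , blanks))
             eZ eY (cleanup-run ly ys l zs b))

    -- The final counter `z′` is chosen before `r`: every input of length `ρ` leads the search to
    -- the same candidate.
    Found : BitString → Set
    Found z = ∃[ z′ ] (U.Computes y (candidate z′ ∷ []) ×
                       (∀ r → length r ≡ ρ → loop r z ⟶* found r (pad z′)))

    pad-increment : ∀ z → pad (increment (pad z)) ≡ increment (pad z)
    pad-increment z = fill-ʳ++-rest k [] (increment (pad z))
      (≤-trans (≤-trans (≤-reflexive (sym (length-candidate z)))
               (≤-trans (m≤m+n _ _) (≤-reflexive (sym (List.length-ʳ++ (candidate z))))))
               (length-increment (pad z)))

    -- The counter value `z′` is one at which the trial must succeed, and the induction follows the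
    -- increments leading to it. An earlier trial may succeed, possibly with another program, which
    -- is then the one found.
    search : ∀ {s d w z′} z → pad z ≡ w → w ↝* z′ → U.Halts s (U.initialᶜ (candidate z′ ∷ [])) d →
      U.output d ≡ y → s + length y < length (padding z′) → Found z
    search z _ p h e n
      with test y (padding z) (candidate z) U.start (proj₂ (U.initialᶜ (candidate z ∷ [])))
                (initial-bounded (candidate z))
    ... | inj₁ (c , j) = z , c , complete j
    search z refl ε h e n | inj₂ (late , _) = ⊥-elim (<⇒≱ n (subst (λ u → length u ≤ _)
      (sym (padding-join (candidate z) (padding z) (length-candidate z)))
      (late (subst (λ p → U.Halts _ (U.initialᶜ (p ∷ [])) _)
                   (candidate-join (candidate z) (padding z) (length-candidate z)) h) e)))
    search z refl (refl ◅ p) h e n | inj₂ (_ , j)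
      with z″ , c , r ← search (increment (pad z)) (pad-increment z) p h e n =
      z″ , c , λ x ∣x∣ → complete j x ∣x∣ ◅◅ (inc-run (pad z) [] ◅◅ r x ∣x∣)

    search-succeeds : ∀ p → length p ≡ k → U.Computes y (p ∷ []) → Found []
    search-succeeds p e (s , d , h , o) = search []
      (trans (fill-ʳ++-rest-[] k []) (cong zeros (sym e))) (↝*-reach p b)
      (subst (λ q → U.Halts s (U.initialᶜ (q ∷ [])) d) (sym (candidate-join p _ e)) h) o
      (subst (b <_) (sym (trans (cong length (padding-join p _ e)) (length-powerOfTwo b))) ≤-refl)
      where
      -- The clock `powerOfTwo b` has `suc b` cells: `s` for the steps, `length y` for the
      -- comparison, and one that must be left for the verdict.
      b = s + length y

    finish-run : ∀ {x} r z → length r ≡ ρ →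
      U.Computes x ((fill (length m) [] (rest ρ z) List.++ r) ∷ []) →
      ∃[ c ] (found (r ʳ++ []) z ⟶* c × advance c ≡ nothing × R.output (config c) ≡ x)
    finish-run r z e (s , d@(q , i ∷ o ∷ us) , h , out) =
      let run , halt = free-run h in
      ((true , sim q) , ts , i ∷ o ∷ us) , load-run true (r ʳ++ []) m z ◅◅
          subst (λ p → ((true , sim U.start) , ts , U.initialᶜ (p ∷ []) .proj₂) ⟶*
                       ((true , sim q) , ts , i ∷ o ∷ us)) (sym loaded) run ,
      halt , out
      where
      r̄ = r ʳ++ []
      ts = at [] r̄ ∷ at [] y ∷ at [] m ∷ blankTape ∷
           at (program false r̄ (length m) z) (rest (length m) (rest (length r̄) z)) ∷ []
      loaded : program true r̄ (length m) z ≡ fill (length m) [] (rest ρ z) List.++ r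
      loaded = trans
        (cong₂ (λ q n → fill (length m) q (rest n z)) (reverse² r) (trans (List.length-ʳ++ r) (trans (+-identityʳ _) e)))
        (fill-++ (length m) [] r (rest ρ z))

  -- The given `p` only guarantees that the search ends; the program found is `π` followed by `σ`
  -- and may differ from `p`. The bits `r` go in reversed because loading reverses them again.
  locate : ∀ ρ ds y p → length p ≡ ρ + value 0 ds → U.Computes y (p ∷ []) →
    ∃[ π ] ∃[ σ ] (length π ≡ value 0 ds × length σ ≡ ρ × U.Computes y ((π List.++ σ) ∷ []) ×
      (∀ r x → length r ≡ ρ → U.Computes x ((π List.++ r) ∷ []) →
        machine computes x from (header ds (r ʳ++ []) ∷ y ∷ [])))
  locate ρ ds y p e c = π , σ , ∣π∣ , ∣σ∣ , cπσ , computes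
    where
    m = ones (value 0 ds)
    open Loop ρ m y
    ∣m∣ : length m ≡ value 0 ds
    ∣m∣ = List.length-replicate (value 0 ds)
    F : Found []
    F = search-succeeds p (trans e (cong (ρ +_) (sym ∣m∣))) c
    z = pad (proj₁ F)
    π = fill (length m) [] (rest ρ z)
    σ = fill ρ [] z
    ∣π∣ = trans (length-fill (length m) [] (rest ρ z)) (trans (+-identityʳ _) ∣m∣)
    ∣σ∣ = trans (length-fill ρ [] z) (+-identityʳ _)
    π++σ : candidate (proj₁ F) ≡ π List.++ σ
    π++σ = trans (sym (candidate-join _ _ (length-candidate (proj₁ F))))
      (trans (sym (fill-+ ρ (length m) [] z)) (fill-++ (length m) [] σ (rest ρ z)))
    cπσ = subst (λ q → U.Computes y (q ∷ [])) π++σ (proj₁ (proj₂ F))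
    computes : ∀ r x → length r ≡ ρ → U.Computes x ((π List.++ r) ∷ []) →
        machine computes x from (header ds (r ʳ++ []) ∷ y ∷ [])
    computes r x e c =
      let d , run , halt , out = finish-run r z e c
          s , h = ⟶*-halts (parse-run ds 0 (r ʳ++ []) ◅◅
                    (proj₂ (proj₂ F) (r ʳ++ []) (trans (List.length-ʳ++ r) (trans (+-identityʳ _) e)) ◅◅ run)) halt
      in R.Computes⇒computes (header ds (r ʳ++ []) ∷ y ∷ []) (s , config d , h , out)

-- Counting

dbl-+ : ∀ v w → dbl v w ≡ v + v + w
dbl-+ zero    w = refl
dbl-+ (suc v) w = trans (dbl-+ v (suc (suc w)))
  (solve 2 (λ v w → v :+ v :+ (con 2 :+ w) := con 1 :+ v :+ (con 1 :+ v) :+ w) refl v w)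
  where open +-*-Solver

dbl-0 : ∀ v → dbl v 0 ≡ v + v
dbl-0 v = trans (dbl-+ v 0) (+-identityʳ _)

halve : ∀ n → ∃[ h ] ∃[ b ] n ≡ bit b (dbl h 0)
halve zero    = 0 , false , refl
halve (suc n) with halve n
... | h , false , e = h , true , cong suc e
... | h , true  , e = suc h , false ,
  trans (cong suc e) (trans (cong (suc ∘ suc) (dbl-0 h)) (trans (cong suc (sym (+-suc h h))) (sym (dbl-0 (suc h)))))

double≤ : ∀ b h → h + h ≤ bit b (dbl h 0)
double≤ true  h = m≤n⇒m≤1+n (≤-reflexive (sym (dbl-0 h)))
double≤ false h = ≤-reflexive (sym (dbl-0 h))

quadruple≤ : ∀ b b′ g → 4 * g ≤ bit b′ (dbl (bit b (dbl g 0)) 0)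
quadruple≤ b b′ g = ≤-trans
  (≤-reflexive (solve 1 (λ g → con 4 :* g := g :+ g :+ (g :+ g)) refl g))
  (≤-trans (+-mono-≤ (double≤ b g) (double≤ b g)) (double≤ b′ (bit b (dbl g 0))))
  where open +-*-Solver

value-snoc : ∀ v ds b b′ →
  value v (ds List.++ (b , b′) ∷ []) ≡ bit b′ (dbl (bit b (dbl (value v ds) 0)) 0)
value-snoc v []       b b′ = refl
value-snoc v (_ ∷ ds) b b′ = value-snoc _ ds b b′

-- Leading zeros give all codes the same length, so the cost of the header is exact.
digits : ∀ D n → n < 4 ^ D → ∃[ ds ] (length ds ≡ D × value 0 ds ≡ n)
digits zero    zero    _         = [] , refl , refl
digits zero    (suc n) (s≤s ())
digits (suc D) n       n<4^
  with h , b′ , refl ← halve n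
  with g , b , refl ← halve h
  with ds , e , refl ← digits D g (*-cancelˡ-< 4 _ _ (≤-<-trans (quadruple≤ b b′ g) n<4^))
  = ds List.++ (b , b′) ∷ [] , trans (List.length-++ ds) (trans (+-comm _ 1) (cong suc e)) , value-snoc 0 ds b b′

length-header : ∀ ds r → length (header ds r) ≡ 3 * length ds + suc (length r)
length-header []       r = refl
length-header (_ ∷ ds) r = trans (cong (3 +_) (length-header ds r))
  (solve 2 (λ d r → con 3 :+ (con 3 :* d :+ r) := con 3 :* (con 1 :+ d) :+ r) refl (length ds) (suc (length r)))
  where open +-*-Solver

bitFin : Bool → Fin 2
bitFin false = 0F
bitFin true  = 1F

bitFin-injective : ∀ {b b′} → bitFin b ≡ bitFin b′ → b ≡ b′
bitFin-injective {false} {false} _ = refl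
bitFin-injective {true}  {true}  _ = refl

-- Short strings are filled up with zeros, so only strings of equal length are told apart. Keys of
-- programs of equal length do have equal length.
code : ∀ m → BitString → Fin (2 ^ m)
code zero    _       = 0F
code (suc m) []      = combine (bitFin false) (code m [])
code (suc m) (b ∷ l) = combine (bitFin b) (code m l)

code-injective : ∀ m l l′ → length l ≤ m → length l ≡ length l′ → code m l ≡ code m l′ → l ≡ l′
code-injective m       []      []        _       _ _ = refl
code-injective (suc m) (b ∷ l) (b′ ∷ l′) (s≤s p) e q
  with b≡ , l≡ ← combine-injective (bitFin b) (code m l) (bitFin b′) (code m l′) q =
  cong₂ _∷_ (bitFin-injective b≡) (code-injective m l l′ p (suc-injective e) l≡)

n<4^n : ∀ n → n < 4 ^ n
n<4^n zero    = s≤s z≤n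
n<4^n (suc n) = ≤-trans (+-mono-≤ (≤-trans (s≤s z≤n) (n<4^n n)) (n<4^n n))
  (≤-trans (m≤m+n _ _) (≤-reflexive (solve 1 (λ p → p :+ p :+ (p :+ p) := con 4 :* p) refl (4 ^ n))))
  where open +-*-Solver

log₄ : ∀ n D fuel → 4 ^ D ≤ n → n < 4 ^ (D + fuel) → ∃[ E ] (D ≤ E × 4 ^ E ≤ n × n < 4 ^ suc E)
log₄ n D zero    p q = ⊥-elim (<⇒≱ q (subst (λ d → 4 ^ d ≤ n) (sym (+-identityʳ D)) p))
log₄ n D (suc f) p q with n <? 4 ^ suc D
... | yes r = D , ≤-refl , p , r
... | no ¬r with E , a , b , c ← log₄ n (suc D) f (≮⇒≥ ¬r) (subst (λ d → n < 4 ^ d) (+-suc D f) q) =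
  E , <⇒≤ a , b , c

difference-≤ : ∀ k l α → ℤ.+ k ℤ.- ℤ.+ l ℤ.≤ ℤ.+ α → k ≤ l + α
difference-≤ k l α p with k ≤? l
... | yes q = ≤-trans q (m≤m+n l α)
... | no ¬q = ≤-trans (m≤n+m∸n k l) (+-monoʳ-≤ l
  (ℤ.drop‿+≤+ (subst (ℤ._≤ ℤ.+ α) (trans (ℤ.m-n≡m⊖n k l) (ℤ.⊖-≥ (<⇒≤ (≰⇒> ¬q)))) p)))

toList-injective : ∀ {n} (v w : Vec Bool n) → toList v ≡ toList w → v ≡ w
toList-injective []      []      _ = refl
toList-injective (b ∷ v) (c ∷ w) e =
  cong₂ _∷_ (List.∷-injectiveˡ e) (toList-injective v w (List.∷-injectiveʳ e))

-- Descent on program length: whether a shorter program exists is undecidable, but may be decided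
-- under the double negation.
complexity-exists : ∀ {a} (T : TM (suc a)) {x} p ys → T computes x from (p ∷ ys) →
  ¬ ¬ (∃[ k ] (k ≤ length p × IsComplexity T x ys k))
complexity-exists T {x} p ys = go (suc (length p)) p ≤-refl
  where
  go : ∀ n p → length p < n → T computes x from (p ∷ ys) → ¬ ¬ (∃[ k ] (k ≤ length p × IsComplexity T x ys k))
  go (suc n) p (s≤s p≤n) c ¬k =
   ¬¬-excluded-middle {A = ∃[ q ] (length q < length p × T computes x from (q ∷ ys))} λ where
    (yes (q , q<p , c′)) → go n q (<-≤-trans q<p p≤n) c′ (λ (k , k≤q , K) → ¬k (k , ≤-trans k≤q (<⇒≤ q<p) , K))
    (no ¬q) → ¬k (length p , ≤-refl , (p , refl , c) , λ q c′ → ≮⇒≥ (λ q<p → ¬q (q , q<p , c′)))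

-- A header of D + 2 digits takes 3 (D + 2) + 1 bits and simulating the machine c₂
-- more, so the shared prefix must exceed α by at least 8 + 3 D + c₂.
holes<pigeons : ∀ c₁ c₂ n D α → c₁ < n → 8 + c₂ < D → 4 ^ D ≤ n →
  suc (n + c₁) * 2 ^ (α + (8 + 3 * D + c₂)) < 2 * n ^ 3 * 2 ^ α
holes<pigeons c₁ c₂ n D α c₁<n c₂<D 4^D≤n = begin-strict
  suc (n + c₁) * 2 ^ (α + e)     ≡⟨ cong (suc (n + c₁) *_) (^-distribˡ-+-* 2 α e) ⟩
  suc (n + c₁) * (2 ^ α * 2 ^ e) <⟨ *-monoʳ-< (suc (n + c₁)) (*-monoʳ-< (2 ^ α) {{m^n≢0 2 α}} 2^e<n²) ⟩
  suc (n + c₁) * (2 ^ α * (n * n)) ≤⟨ *-monoˡ-≤ _ (≤-trans (≤-reflexive (sym (+-suc n c₁))) (+-monoʳ-≤ n c₁<n)) ⟩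
  (n + n) * (2 ^ α * (n * n))    ≡⟨ solve 2 (λ n p → (n :+ n) :* (p :* (n :* n)) := con 2 :* (n :^ 3) :* p) refl n (2 ^ α) ⟩
  2 * n ^ 3 * 2 ^ α              ∎
  where
  open ≤-Reasoning
  open +-*-Solver
  e = 8 + 3 * D + c₂
  e<4D : e < 2 * D + 2 * D
  e<4D = begin-strict
    8 + 3 * D + c₂   ≡⟨ solve 2 (λ d c → con 8 :+ con 3 :* d :+ c := con 3 :* d :+ (con 8 :+ c)) refl D c₂ ⟩
    3 * D + (8 + c₂) <⟨ +-monoʳ-< (3 * D) c₂<D ⟩
    3 * D + D        ≡⟨ solve 1 (λ d → con 3 :* d :+ d := con 2 :* d :+ con 2 :* d) refl D ⟩
    2 * D + 2 * D    ∎
  2^e<n² : 2 ^ e < n * n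
  2^e<n² = begin-strict
    2 ^ e                     <⟨ ^-monoʳ-< 2 (s≤s (s≤s z≤n)) e<4D ⟩
    2 ^ (2 * D + 2 * D)       ≡⟨ ^-distribˡ-+-* 2 (2 * D) (2 * D) ⟩
    2 ^ (2 * D) * 2 ^ (2 * D) ≡⟨ cong₂ _*_ (^-*-assoc 2 2 D) (^-*-assoc 2 2 D) ⟨
    4 ^ D * 4 ^ D             ≤⟨ *-mono-≤ 4^D≤n 4^D≤n ⟩
    n * n                     ∎

-- Shared keys and the pigeonhole

module Collision (U : TM 1) (m D : ℕ) where
  open Find U

  -- In the case `long` the key is the prefix that the machine itself recovers from `x`; in the case
  -- `short` it is a whole program for `x`.
  data Keyed (x : BitString) (k : ℕ) (key : BitString) : Set where
    long  : m ≤ k → length key ≡ m →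
      ∃[ σ ] (length σ ≡ k ∸ m × U.Computes x ((key List.++ σ) ∷ [])) →
      (∀ r x′ → length r ≡ k ∸ m → U.Computes x′ ((key List.++ r) ∷ []) →
       ∃[ p ] (length p ≡ 3 * D + suc (k ∸ m) × machine computes x′ from (p ∷ x ∷ []))) →
      Keyed x k key
    short : k < m → length key ≡ k → U.Computes x (key ∷ []) → Keyed x k key

  keyed : ∀ x k p → length p ≡ k → k < 4 ^ D → U computes x from (p ∷ []) → ∃[ key ] Keyed x k key
  keyed x k p e k<4^D c with m ≤? k
  ... | no m≰k = p , short (≰⇒> m≰k) e (U.computes⇒Computes (p ∷ []) c)
  ... | yes m≤k
    -- Although `α` is arbitrary, `m ≤ k` bounds `m` here, so `D` digits suffice.
    with ds , ∣ds∣ , refl ← digits D m (≤-<-trans m≤k k<4^D)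
    with π , σ , ∣π∣ , ∣σ∣ , cσ , f ← locate (k ∸ value 0 ds) ds x p
           (trans e (sym (m∸n+n≡m m≤k))) (U.computes⇒Computes (p ∷ []) c) =
    π , long m≤k ∣π∣ (σ , ∣σ∣ , cσ) (λ r x′ ∣r∣ c′ →
      header ds (r ʳ++ []) ,
      trans (length-header ds (r ʳ++ []))
        (cong₂ (λ d l → 3 * d + suc l) ∣ds∣ (trans (List.length-ʳ++ r) (trans (+-identityʳ _) ∣r∣))) ,
      f r x′ ∣r∣ c′)

  -- The machine recovers the key from `x`, and the remaining bits `σ` of a program for `x′`
  -- complete it. Two short keys would be one program with two outputs.
  collide : ∀ {x x′ k key} → Keyed x k key → Keyed x′ k key → x ≢ x′ →
    m ≤ k × (∃[ p ] (length p ≡ 3 * D + suc (k ∸ m) × machine computes x′ from (p ∷ x ∷ [])))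
  collide (long m≤k _ _ f) (long _ _ (σ , ∣σ∣ , c) _) _    = m≤k , f σ _ ∣σ∣ c
  collide (long m≤k _ _ _) (short k<m _ _)            _    = ⊥-elim (<⇒≱ k<m m≤k)
  collide (short k<m _ _)  (long m≤k _ _ _)           _    = ⊥-elim (<⇒≱ k<m m≤k)
  collide {key = key} (short _ _ c) (short _ _ c′)    x≢x′ =
    ⊥-elim (x≢x′ (U.Computes-deterministic (key ∷ []) c c′))

  length-key≤ : ∀ {x k key} → Keyed x k key → length key ≤ m
  length-key≤ (long _ e _ _)  = ≤-reflexive e
  length-key≤ (short k<m e _) = ≤-trans (≤-reflexive e) (<⇒≤ k<m)

  length-key≡ : ∀ {x x′ k key key′} → Keyed x k key → Keyed x′ k key′ → length key ≡ length key′
  length-key≡ (long _ e _ _)   (long _ e′ _ _)  = trans e (sym e′)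
  length-key≡ (long m≤k _ _ _) (short k<m _ _)  = ⊥-elim (<⇒≱ k<m m≤k)
  length-key≡ (short k<m _ _)  (long m≤k _ _ _) = ⊥-elim (<⇒≱ k<m m≤k)
  length-key≡ (short _ e _)    (short _ e′ _)   = trans e (sym e′)

theorem4 : (U : TM 1) → Universal U → (V : TM 2) → Universal V →
    ∃[ n₀ ] ∀ (n : ℕ) → n₀ ≤ n → ∀ (α t : ℕ) (x : Fin t → Vec Bool n) →
    Injective _≡_ _≡_ x →
    PairwiseIndependent U V α x →
    t < 2 * n ^ 3 * 2 ^ α
theorem4 U universalU V universalV
  with c₁ , simulateU ← universalU reverser
  with c₂ , simulateV ← universalV (Search.machine U) =
  -- The power makes `E` exceed `8 + c₂`, so that `8 + 3 * E + c₂ < 4 * E`; the other summand gives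
  -- `suc (n + c₁) ≤ n + n`.
  4 ^ (9 + c₂) + suc c₁ , λ n n₀≤n α t x x-injective independent →
    let E , c₂<E , 4^E≤n , n<4^1+E = log₄ n (9 + c₂) n (≤-trans (m≤m+n _ _) n₀≤n)
          (<-≤-trans (n<4^n n) (^-monoʳ-≤ 4 (m≤n+m n (9 + c₂))))
    in ≰⇒> (contradictory n (≤-trans (m≤n+m _ _) n₀≤n) α t x x-injective independent
                           E c₂<E 4^E≤n n<4^1+E)
  where
  contradictory : ∀ n → c₁ < n → ∀ α t (x : Fin t → Vec Bool n) → Injective _≡_ _≡_ x →
    PairwiseIndependent U V α x → ∀ E → 8 + c₂ < E → 4 ^ E ≤ n → n < 4 ^ suc E → ¬ (2 * n ^ 3 * 2 ^ α ≤ t)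
  contradictory n c₁<n α t x x-injective independent E c₂<E 4^E≤n n<4^1+E large =
    sequence (RawMonad.rawApplicative ¬¬-Monad) complexity refute
    where
    -- One digit beyond `suc E` makes room for `n + c₁`, which is less than twice `4 ^ suc E`.
    D = 2 + E
    m = α + (8 + 3 * E + c₂)
    open Collision U m D

    complexity : ∀ i → ¬ ¬ (∃[ k ] (k ≤ n + c₁ × C[ U ] toList (x i) ≔ k))
    complexity i ¬k
      -- The reversed string is a program for `reverser`, whence complexity at most `n + c₁`.
      with q , q≤ , c ← simulateU (toList (x i) ʳ++ []) [] (toList (x i))
             (subst (λ y → reverser computes y from ((toList (x i) ʳ++ []) ∷ [])) (reverse² (toList (x i)))
                    (reverser-computes (toList (x i) ʳ++ []))) =
      complexity-exists U q [] c λ (k , k≤ , K) → ¬k (k , ≤-trans k≤ (≤-trans q≤ (≤-reflexive (cong (_+ c₁)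
        (trans (List.length-ʳ++ (toList (x i))) (trans (+-identityʳ _) (Vec.length-toList (x i))))))) , K)

    n+c₁<4^D : n + c₁ < 4 ^ D
    n+c₁<4^D = begin-strict
      n + c₁                    <⟨ +-mono-< n<4^1+E (<-trans c₁<n n<4^1+E) ⟩
      4 ^ suc E + 4 ^ suc E     ≤⟨ m≤m+n _ _ ⟩
      4 ^ suc E + 4 ^ suc E + (4 ^ suc E + 4 ^ suc E)
        ≡⟨ solve 1 (λ p → p :+ p :+ (p :+ p) := con 4 :* p) refl (4 ^ suc E) ⟩
      4 ^ D                     ∎
      where
      open ≤-Reasoning
      open +-*-Solver

    refute : ¬ (∀ i → ∃[ k ] (k ≤ n + c₁ × C[ U ] toList (x i) ≔ k))
    refute K = let i , j , i<j , e = pigeonhole (<-≤-trans (holes<pigeons c₁ c₂ n E α c₁<n c₂<E 4^E≤n) large) pigeon in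
               absurd i j (<⇒≢ i<j) (combine-injective (level i) (code m (key i)) (level j) (code m (key j)) e)
      where
      k : Fin t → ℕ
      k i = proj₁ (K i)
      k≤ : ∀ i → k i ≤ n + c₁
      k≤ i = proj₁ (proj₂ (K i))
      C : ∀ i → C[ U ] toList (x i) ≔ k i
      C i = proj₂ (proj₂ (K i))
      keys : ∀ i → ∃[ key ] Keyed (toList (x i)) (k i) key
      keys i with (p , e , c) , _ ← C i = keyed (toList (x i)) (k i) p e (≤-<-trans (k≤ i) n+c₁<4^D) c
      key : Fin t → BitString
      key i = proj₁ (keys i)
      level : Fin t → Fin (suc (n + c₁))
      level i = fromℕ< (s≤s (k≤ i))
      pigeon : Fin t → Fin (suc (n + c₁) * 2 ^ m)
      pigeon i = combine (level i) (code m (key i))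

      absurd : ∀ i j → i ≢ j → level i ≡ level j × code m (key i) ≡ code m (key j) → ⊥
      absurd i j i≢j (level≡ , code≡) = contradict
        (collide (proj₂ (keys i)) Kj (λ e → i≢j (x-injective (toList-injective _ _ e))))
        where
        k≡ : k j ≡ k i
        k≡ = sym (fromℕ<-injective _ _ (s≤s (k≤ i)) (s≤s (k≤ j)) level≡)
        Kj′ : Keyed (toList (x j)) (k i) (key j)
        Kj′ = subst (λ l → Keyed (toList (x j)) l (key j)) k≡ (proj₂ (keys j))
        Kj : Keyed (toList (x j)) (k i) (key i)
        Kj = subst (Keyed (toList (x j)) (k i))
          (sym (code-injective m (key i) (key j) (length-key≤ (proj₂ (keys i)))
                 (length-key≡ (proj₂ (keys i)) Kj′) code≡)) Kj′
        contradict : m ≤ k i × (∃[ p ] (length p ≡ 3 * D + suc (k i ∸ m) ×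
                       Search.machine U computes toList (x j) from (p ∷ toList (x i) ∷ []))) → ⊥
        contradict (m≤k , p , ∣p∣ , c) with q , q≤ , c′ ← simulateV p (toList (x i) ∷ []) (toList (x j)) c =
          complexity-exists V q (toList (x i) ∷ []) c′ λ (l , l≤q , L) →
            -- The header, the `k i ∸ m` remaining bits, `c₂` and `α` add up to exactly one less
            -- than `k i`; this fixes the constant 8 in `m`.
            <-irrefl refl (begin-strict
              k i                                   ≤⟨ difference-≤ (k i) l α
                (independent j i (i≢j ∘ sym) (k i) l (subst (C[ U ] toList (x j) ≔_) k≡ (C j)) L) ⟩
              l + α                                 ≤⟨ +-monoˡ-≤ α (≤-trans l≤q q≤) ⟩
              length p + c₂ + α                     ≡⟨ cong (λ n → n + c₂ + α) ∣p∣ ⟩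
              3 * D + suc (k i ∸ m) + c₂ + α        <⟨ n<1+n _ ⟩
              suc (3 * D + suc (k i ∸ m) + c₂ + α)
                ≡⟨ solve 4 (λ d s c a → con 1 :+ (con 3 :* (con 2 :+ d) :+ (con 1 :+ s) :+ c :+ a)
                                     := a :+ (con 8 :+ con 3 :* d :+ c) :+ s) refl E (k i ∸ m) c₂ α ⟩
              m + (k i ∸ m)                         ≡⟨ m+[n∸m]≡n m≤k ⟩
              k i                                   ∎)
          where
          open ≤-Reasoning
          open +-*-Solver
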